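{- Let $\Delta\ne0$ be an integer. There is a constant $c(\Delta)$, depending only on $\Delta$, such that for all real $X\ge1$ $$\sum_{\substack{r_1\ge1\\ (r_1,\Delta)=1}}\ \sum_{\substack{r_2\ge1\\ (r_2,\Delta)=1}}\ \sum_{\substack{d_1\ge1\\ q\mid d_1\Rightarrow q\mid\Delta}}\ \sum_{\substack{d_2\ge1\\ q\mid d_2\Rightarrow q\mid\Delta\\ [r_1^2d_1,r_2^2d_2]\ge X}}\frac{1}{[r_1^2d_1,r_2^2d_2]}\le c(\Delta)\,\frac{(\log X)^2+1}{\sqrt X}.$$
   Context: $r_1,r_2,d_1,d_2$ run over positive integers; $q$ denotes primes, so "$q\mid d\Rightarrow q\mid\Delta$" means every prime factor of $d$ divides $\Delta$. $(\cdot,\cdot)$ is the gcd and $[\cdot,\cdot]$ the lcm. -}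

module Defs where

open import Data.Nat.Base as ℕ using (ℕ; zero; suc)
import Data.Nat.Properties as ℕP
open import Data.Nat.Coprimality using (1-coprimeTo) renaming (sym to sym-coprime)
open import Data.Integer.Base as ℤ using (ℤ; -[1+_]; 1ℤ)
import Data.Integer.Properties as ℤP
open import Data.Rational.Base
open import Data.Rational.Properties
import Data.Integer.Divisibility as ℤ∣
open import Data.Integer.GCD using (gcd)
import Data.Nat.Divisibility as ℕ∣
open import Data.Nat.LCM using (lcm)
open import Data.Nat.Primality using (Prime)
open import Data.List.Base using (List; foldr; map)
open import Data.List.Relation.Unary.All using (All)
open import Data.List.Relation.Unary.Unique.Propositional using (Unique)
import Data.Rational.Unnormalised.Base as ℚᵘ
import Data.Rational.Unnormalised.Properties as ℚᵘP
open import Data.Rational.Solver using (module +-*-Solver)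
open import Algebra.Definitions.RawSemiring +-*-rawSemiring using (_^_)
open import Data.Product.Base using (∃; _×_; _,_; proj₁; proj₂)
open import Data.Sum.Base using (_⊎_; inj₁; inj₂)
open import Relation.Nullary using (yes; no; contradiction)
open import Relation.Binary.PropositionalEquality

open +-*-Solver using (solve; con; _:+_; _:*_; _:-_; :-_; _:=_)

≤-by : ∀ {p q} s → q ≡ p + s → 0ℚ ≤ s → p ≤ q
≤-by {p} s refl 0≤s = ≤-trans (≤-reflexive (sym (+-identityʳ p))) (+-monoʳ-≤ p 0≤s)

≤⇒0≤- : ∀ {p q} → p ≤ q → 0ℚ ≤ q - p
≤⇒0≤- {p} {q} p≤q = ≤-trans (≤-reflexive (sym (+-inverseʳ p))) (+-monoˡ-≤ (- p) p≤q)

0≤1 : 0ℚ ≤ 1ℚ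
0≤1 = nonNegative⁻¹ 1ℚ

0<1 : 0ℚ < 1ℚ
0<1 = positive⁻¹ 1ℚ

0<½ : 0ℚ < ½
0<½ = positive⁻¹ ½

0≤+ : ∀ {p q} → 0ℚ ≤ p → 0ℚ ≤ q → 0ℚ ≤ p + q
0≤+ = +-mono-≤

0<+ : ∀ {p q} → 0ℚ < p → 0ℚ ≤ q → 0ℚ < p + q
0<+ = +-mono-<-≤

*-mono : ∀ {p q r s} → 0ℚ ≤ p → p ≤ q → 0ℚ ≤ r → r ≤ s → p * r ≤ q * s
*-mono {p} {q} {r} {s} 0≤p p≤q 0≤r r≤s = ≤-trans
  (*-monoʳ-≤-nonNeg r {{nonNegative 0≤r}} p≤q)
  (*-monoˡ-≤-nonNeg q {{nonNegative (≤-trans 0≤p p≤q)}} r≤s)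

0≤* : ∀ {p q} → 0ℚ ≤ p → 0ℚ ≤ q → 0ℚ ≤ p * q
0≤* 0≤p 0≤q = *-mono ≤-refl 0≤p ≤-refl 0≤q

0<* : ∀ {p q} → 0ℚ < p → 0ℚ < q → 0ℚ < p * q
0<* {p} {q} 0<p 0<q =
  positive⁻¹ (p * q) {{pos*pos⇒pos p {{positive 0<p}} q {{positive 0<q}}}}

*-monoˡ : ∀ {p q r} → 0ℚ ≤ r → p ≤ q → r * p ≤ r * q
*-monoˡ {r = r} 0≤r = *-monoˡ-≤-nonNeg r {{nonNegative 0≤r}}

p≤∣p∣ : ∀ p → p ≤ ∣ p ∣
p≤∣p∣ p with ≤-total 0ℚ p
... | inj₁ 0≤p = ≤-reflexive (sym (0≤p⇒∣p∣≡p 0≤p))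
... | inj₂ p≤0 = ≤-trans p≤0 (0≤∣p∣ p)

∣∣≤ : ∀ {p q} → p ≤ q → - p ≤ q → ∣ p ∣ ≤ q
∣∣≤ {p} p≤q -p≤q with ∣p∣≡p∨∣p∣≡-p p
... | inj₁ eq = ≤-trans (≤-reflexive eq) p≤q
... | inj₂ eq = ≤-trans (≤-reflexive eq) -p≤q

∣-∣-sym : ∀ p q → ∣ p - q ∣ ≡ ∣ q - p ∣
∣-∣-sym p q = trans (sym (∣-p∣≡∣p∣ (p - q)))
  (cong ∣_∣ (solve 2 (λ p q → :- (p :- q) := q :- p) refl p q))

∣-∣≤ : ∀ p q {r} → p - q ≤ r → q - p ≤ r → ∣ p - q ∣ ≤ r
∣-∣≤ p q h h′ = ∣∣≤ h
  (≤-trans (≤-reflexive (solve 2 (λ p q → :- (p :- q) := q :- p) refl p q)) h′)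

⊓-pos : ∀ {p q} → 0ℚ < p → 0ℚ < q → 0ℚ < p ⊓ q
⊓-pos {p} {q} 0<p 0<q with ⊓-sel p q
... | inj₁ eq = subst (0ℚ <_) (sym eq) 0<p
... | inj₂ eq = subst (0ℚ <_) (sym eq) 0<q

-- The reciprocal, made total by sending 0 to 0.
recip : ℚ → ℚ
recip p with p ≟ 0ℚ
... | yes _   = 0ℚ
... | no  p≢0 = (1/ p) {{≢-nonZero p≢0}}

*-recip : ∀ {p} → 0ℚ < p → p * recip p ≡ 1ℚ
*-recip {p} 0<p with p ≟ 0ℚ
... | yes p≡0 = contradiction (sym p≡0) (<⇒≢ 0<p)
... | no  p≢0 = *-inverseʳ p {{≢-nonZero p≢0}}

0<recip : ∀ {p} → 0ℚ < p → 0ℚ < recip p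
0<recip {p} 0<p with recip p ≤? 0ℚ
... | no  r≰0 = ≰⇒> r≰0
... | yes r≤0 = contradiction
  (≤-trans (≤-reflexive (sym (*-recip 0<p)))
    (≤-trans (*-monoˡ (<⇒≤ 0<p) r≤0) (≤-reflexive (*-zeroʳ p))))
  (λ 1≤0 → <-irrefl refl (<-≤-trans 0<1 1≤0))

recip-antimono : ∀ {p q} → 0ℚ < p → p ≤ q → recip q ≤ recip p
recip-antimono {p} {q} 0<p p≤q = ≤-by (recip p * recip q * (q - p)) eq
  (0≤* (0≤* (<⇒≤ (0<recip 0<p)) (<⇒≤ (0<recip 0<q))) (≤⇒0≤- p≤q))
  where
  0<q = <-≤-trans 0<p p≤q
  eq : recip p ≡ recip q + recip p * recip q * (q - p)
  eq = begin
    recip p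
      ≡⟨ solve 2 (λ r s → r := s :+ (r :* con 1ℚ :- con 1ℚ :* s)) refl (recip p) (recip q) ⟩
    recip q + (recip p * 1ℚ - 1ℚ * recip q)
      ≡⟨ cong₂ (λ a b → recip q + (recip p * a - b * recip q))
           (sym (*-recip 0<q)) (sym (*-recip 0<p)) ⟩
    recip q + (recip p * (q * recip q) - p * recip p * recip q)
      ≡⟨ solve 4 (λ p q r s → s :+ (r :* (q :* s) :- p :* r :* s)
                           := s :+ r :* s :* (q :- p)) refl p q (recip p) (recip q) ⟩
    recip q + recip p * recip q * (q - p) ∎
    where open ≡-Reasoning

ι : ℕ → ℚ
ι n = mkℚ (ℤ.+ n) 0 (sym-coprime (1-coprimeTo n))

ι-suc : ∀ n → ι (suc n) ≡ 1ℚ + ι n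
ι-suc n = toℚᵘ-injective (ℚᵘP.≃-trans
  (ℚᵘ.*≡* (cong (ℤ._* 1ℤ) (cong (λ z → 1ℤ ℤ.+ z) (sym (ℤP.*-identityʳ (ℤ.+ n))))))
  (ℚᵘP.≃-sym (toℚᵘ-homo-+ 1ℚ (ι n))))

0≤ι : ∀ n → 0ℚ ≤ ι n
0≤ι zero    = ≤-refl
0≤ι (suc n) = ≤-trans (0≤+ 0≤1 (0≤ι n)) (≤-reflexive (sym (ι-suc n)))

1≤ιsuc : ∀ n → 1ℚ ≤ ι (suc n)
1≤ιsuc n = ≤-by (ι n) (ι-suc n) (0≤ι n)

0<ιsuc : ∀ n → 0ℚ < ι (suc n)
0<ιsuc n = <-≤-trans 0<1 (1≤ιsuc n)

ι-mono : ∀ {m n} → m ℕ.≤ n → ι m ≤ ι n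
ι-mono {n = n} ℕ.z≤n = 0≤ι n
ι-mono (ℕ.s≤s {m} {n} m≤n) =
  subst₂ _≤_ (sym (ι-suc m)) (sym (ι-suc n)) (+-monoʳ-≤ 1ℚ (ι-mono m≤n))

ι-* : ∀ m n → ι (m ℕ.* n) ≡ ι m * ι n
ι-* zero    n = sym (*-zeroˡ (ι n))
ι-* (suc m) n = begin
  ι (n ℕ.+ m ℕ.* n)    ≡⟨ ι-+ n (m ℕ.* n) ⟩
  ι n + ι (m ℕ.* n)    ≡⟨ cong (ι n +_) (ι-* m n) ⟩
  ι n + ι m * ι n      ≡⟨ solve 2 (λ m n → n :+ m :* n := (con 1ℚ :+ m) :* n) refl (ι m) (ι n) ⟩
  (1ℚ + ι m) * ι n     ≡⟨ cong (_* ι n) (ι-suc m) ⟨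
  ι (suc m) * ι n      ∎
  where
  open ≡-Reasoning
  ι-+ : ∀ m n → ι (m ℕ.+ n) ≡ ι m + ι n
  ι-+ zero    n = sym (+-identityˡ (ι n))
  ι-+ (suc m) n = begin
    ι (suc (m ℕ.+ n))   ≡⟨ ι-suc (m ℕ.+ n) ⟩
    1ℚ + ι (m ℕ.+ n)    ≡⟨ cong (1ℚ +_) (ι-+ m n) ⟩
    1ℚ + (ι m + ι n)    ≡⟨ +-assoc 1ℚ (ι m) (ι n) ⟨
    1ℚ + ι m + ι n      ≡⟨ cong (_+ ι n) (ι-suc m) ⟨
    ι (suc m) + ι n     ∎

p≤ι∣↥p∣ : ∀ p → p ≤ ι ℤ.∣ ↥ p ∣
p≤ι∣↥p∣ p@(mkℚ -[1+ _ ] _ _) = ≤-trans (nonPositive⁻¹ p) (0≤ι _)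
p≤ι∣↥p∣ p@(mkℚ (ℤ.+ n) d _)  =
  *≤* (ℤP.*-monoˡ-≤-nonNeg (ℤ.+ n) (ℤ.+≤+ (ℕ.s≤s ℕ.z≤n)))

-- ε n = 1/(n+1)
ε : ℕ → ℚ
ε n = recip (ι (suc n))

0<ε : ∀ n → 0ℚ < ε n
0<ε n = 0<recip (0<ιsuc n)

ε-antimono : ∀ {m n} → m ℕ.≤ n → ε n ≤ ε m
ε-antimono {m} m≤n = recip-antimono (0<ιsuc m) (ι-mono (ℕ.s≤s m≤n))

archimedean : ∀ {p} → 0ℚ < p → ∃ λ N → ∀ n → N ℕ.≤ n → ε n ≤ p
archimedean {p} 0<p = N , λ n N≤n → ≤-trans (ε-antimono N≤n) εN≤p
  where
  N = ℤ.∣ ↥ recip p ∣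
  εN≤p : ε N ≤ p
  εN≤p = ≤-by (ε N * p * (ι (suc N) - recip p)) eq
    (0≤* (0≤* (<⇒≤ (0<ε N)) (<⇒≤ 0<p))
      (≤⇒0≤- (≤-trans (p≤ι∣↥p∣ (recip p)) (ι-mono (ℕP.n≤1+n N)))))
    where
    eq : p ≡ ε N + ε N * p * (ι (suc N) - recip p)
    eq = begin
      p ≡⟨ solve 2 (λ e p → p := e :+ (p :* con 1ℚ :- con 1ℚ :* e)) refl (ε N) p ⟩
      ε N + (p * 1ℚ - 1ℚ * ε N)
        ≡⟨ cong₂ (λ a b → ε N + (p * a - b * ε N)) (sym (*-recip (0<ιsuc N))) (sym (*-recip 0<p)) ⟩
      ε N + (p * (ι (suc N) * ε N) - p * recip p * ε N)
        ≡⟨ solve 4 (λ p n e r → e :+ (p :* (n :* e) :- p :* r :* e) := e :+ e :* p :* (n :- r))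
             refl p (ι (suc N)) (ε N) (recip p) ⟩
      ε N + ε N * p * (ι (suc N) - recip p) ∎
      where open ≡-Reasoning

Vanishing : (ℕ → ℕ → ℚ) → Set
Vanishing D = ∀ η → 0ℚ < η → ∃ λ N → ∀ m n → N ℕ.≤ m → N ℕ.≤ n → D m n ≤ η

half+half : ∀ p → p * ½ + p * ½ ≡ p
half+half = solve 1 (λ p → p :* con ½ :+ p :* con ½ := p) refl

vanishing-+ : ∀ {D E} → Vanishing D → Vanishing E → Vanishing (λ m n → D m n + E m n)
vanishing-+ vD vE η 0<η = M ℕ.⊔ N , λ m n h h′ → subst (_ ≤_) (half+half η)
  (+-mono-≤ (hD m n (ℕP.m⊔n≤o⇒m≤o M N h) (ℕP.m⊔n≤o⇒m≤o M N h′))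
            (hE m n (ℕP.m⊔n≤o⇒n≤o M N h) (ℕP.m⊔n≤o⇒n≤o M N h′)))
  where
  M  = proj₁ (vD (η * ½) (0<* 0<η 0<½))
  hD = proj₂ (vD (η * ½) (0<* 0<η 0<½))
  N  = proj₁ (vE (η * ½) (0<* 0<η 0<½))
  hE = proj₂ (vE (η * ½) (0<* 0<η 0<½))

*-recip-cancel : ∀ {p} → 0ℚ < p → ∀ q → p * (q * recip p) ≡ q
*-recip-cancel {p} 0<p q = begin
  p * (q * recip p)  ≡⟨ solve 3 (λ p q r → p :* (q :* r) := q :* (p :* r)) refl p q (recip p) ⟩
  q * (p * recip p)  ≡⟨ cong (q *_) (*-recip 0<p) ⟩
  q * 1ℚ             ≡⟨ *-identityʳ q ⟩
  q                  ∎
  where open ≡-Reasoning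

vanishing-dominated : ∀ {D E} K → 0ℚ < K → Vanishing E →
  (∃ λ N → ∀ m n → N ℕ.≤ m → N ℕ.≤ n → D m n ≤ K * E m n) → Vanishing D
vanishing-dominated K 0<K vE (M , h) η 0<η = M ℕ.⊔ N , λ m n g g′ →
  subst (_ ≤_) (*-recip-cancel 0<K η) (≤-trans
    (h m n (ℕP.m⊔n≤o⇒m≤o M N g) (ℕP.m⊔n≤o⇒m≤o M N g′))
    (*-monoˡ (<⇒≤ 0<K) (hE m n (ℕP.m⊔n≤o⇒n≤o M N g) (ℕP.m⊔n≤o⇒n≤o M N g′))))
  where
  small = vE (η * recip K) (0<* 0<η (0<recip 0<K))
  N  = proj₁ small
  hE = proj₂ small

vanishing-ε : Vanishing (λ m n → ε m + ε n)
vanishing-ε η 0<η = proj₁ small , λ m n N≤m N≤n →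
  subst (ε m + ε n ≤_) (half+half η) (+-mono-≤ (proj₂ small m N≤m) (proj₂ small n N≤n))
  where
  small = archimedean (0<* 0<η 0<½)

IsCauchy : (ℕ → ℚ) → Set
IsCauchy x = Vanishing (λ m n → ∣ x m - x n ∣)

-- Equality of reals is x ≤ᴿ y and y ≤ᴿ x, not propositional equality.
record ℝ : Set where
  constructor mkℝ
  field
    seq    : ℕ → ℚ
    cauchy : IsCauchy seq

open ℝ public

infix 4 _≤ᴿ_ _<ᴿ_

_≤ᴿ_ : ℝ → ℝ → Set
x ≤ᴿ y = ∀ η → 0ℚ < η → ∃ λ N → ∀ n → N ℕ.≤ n → seq x n ≤ seq y n + η

_<ᴿ_ : ℝ → ℝ → Set
x <ᴿ y = ∃ λ δ → 0ℚ < δ × ∃ λ N → ∀ n → N ℕ.≤ n → seq x n + δ ≤ seq y n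

fromℚ : ℚ → ℝ
fromℚ p = mkℝ (λ _ → p) λ η 0<η → 0 , λ _ _ _ _ →
  ≤-trans (≤-reflexive (cong ∣_∣ (+-inverseʳ p))) (<⇒≤ 0<η)

fromℕ : ℕ → ℝ
fromℕ n = fromℚ (ι n)

0ᴿ 1ᴿ : ℝ
0ᴿ = fromℚ 0ℚ
1ᴿ = fromℚ 1ℚ

infixl 6 _+ᴿ_ _-ᴿ_
infixl 7 _*ᴿ_ _/ᴿ_⟨_⟩
infix  8 -ᴿ_

_+ᴿ_ : ℝ → ℝ → ℝ
x +ᴿ y = mkℝ (λ n → seq x n + seq y n)
  (vanishing-dominated 1ℚ 0<1 (vanishing-+ (cauchy x) (cauchy y))
    (0 , λ m n _ _ → bound (seq x m) (seq x n) (seq y m) (seq y n)))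
  where
  bound : ∀ a b c d → ∣ (a + c) - (b + d) ∣ ≤ 1ℚ * (∣ a - b ∣ + ∣ c - d ∣)
  bound a b c d = begin
    ∣ (a + c) - (b + d) ∣
      ≡⟨ cong ∣_∣ (solve 4 (λ a b c d → (a :+ c) :- (b :+ d) := (a :- b) :+ (c :- d)) refl a b c d) ⟩
    ∣ (a - b) + (c - d) ∣         ≤⟨ ∣p+q∣≤∣p∣+∣q∣ (a - b) (c - d) ⟩
    ∣ a - b ∣ + ∣ c - d ∣         ≡⟨ *-identityˡ _ ⟨
    1ℚ * (∣ a - b ∣ + ∣ c - d ∣)  ∎
    where open ≤-Reasoning

-ᴿ_ : ℝ → ℝ
-ᴿ x = mkℝ (λ n → - seq x n) λ η 0<η →
  let (N , h) = cauchy x η 0<η in N , λ m n g g′ → ≤-trans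
    (≤-reflexive (trans (cong ∣_∣ (sym (neg-distrib-+ (seq x m) (- seq x n))))
                        (∣-p∣≡∣p∣ (seq x m - seq x n))))
    (h m n g g′)

_-ᴿ_ : ℝ → ℝ → ℝ
x -ᴿ y = x +ᴿ -ᴿ y

bounded : ∀ x → ∃ λ B → 1ℚ ≤ B × ∃ λ N → ∀ n → N ℕ.≤ n → ∣ seq x n ∣ ≤ B
bounded x = 1ℚ + ∣ seq x N ∣ ,
  ≤-by ∣ seq x N ∣ refl (0≤∣p∣ (seq x N)) , N , λ n N≤n → bound (seq x n) (proj₂ close n N N≤n ℕP.≤-refl)
  where
  close = cauchy x 1ℚ 0<1
  N = proj₁ close
  bound : ∀ p → ∣ p - seq x N ∣ ≤ 1ℚ → ∣ p ∣ ≤ 1ℚ + ∣ seq x N ∣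
  bound p h = begin
    ∣ p ∣
      ≡⟨ cong ∣_∣ (solve 2 (λ a b → a := (a :- b) :+ b) refl p (seq x N)) ⟩
    ∣ (p - seq x N) + seq x N ∣   ≤⟨ ∣p+q∣≤∣p∣+∣q∣ (p - seq x N) (seq x N) ⟩
    ∣ p - seq x N ∣ + ∣ seq x N ∣ ≤⟨ +-monoˡ-≤ ∣ seq x N ∣ h ⟩
    1ℚ + ∣ seq x N ∣              ∎
    where open ≤-Reasoning

_*ᴿ_ : ℝ → ℝ → ℝ
x *ᴿ y = mkℝ (λ n → seq x n * seq y n) isCauchy
  where
  bound : ∀ {B C} a b c d → 0ℚ ≤ B → 0ℚ ≤ C → ∣ a ∣ ≤ B → ∣ d ∣ ≤ C →
          ∣ a * c - b * d ∣ ≤ (B + C) * (∣ a - b ∣ + ∣ c - d ∣)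
  bound {B} {C} a b c d 0≤B 0≤C a≤B d≤C = begin
    ∣ a * c - b * d ∣
      ≡⟨ cong ∣_∣ (solve 4 (λ a b c d → a :* c :- b :* d := a :* (c :- d) :+ d :* (a :- b)) refl a b c d) ⟩
    ∣ a * (c - d) + d * (a - b) ∣            ≤⟨ ∣p+q∣≤∣p∣+∣q∣ (a * (c - d)) (d * (a - b)) ⟩
    ∣ a * (c - d) ∣ + ∣ d * (a - b) ∣        ≡⟨ cong₂ _+_ (∣p*q∣≡∣p∣*∣q∣ a (c - d)) (∣p*q∣≡∣p∣*∣q∣ d (a - b)) ⟩
    ∣ a ∣ * ∣ c - d ∣ + ∣ d ∣ * ∣ a - b ∣    ≤⟨ +-mono-≤ (*-mono (0≤∣p∣ a) a≤B (0≤∣p∣ (c - d)) ≤-refl)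
                                                       (*-mono (0≤∣p∣ d) d≤C (0≤∣p∣ (a - b)) ≤-refl) ⟩
    B * ∣ c - d ∣ + C * ∣ a - b ∣
      ≤⟨ ≤-by (B * ∣ a - b ∣ + C * ∣ c - d ∣)
           (solve 4 (λ B C u v → (B :+ C) :* (u :+ v) := B :* v :+ C :* u :+ (B :* u :+ C :* v))
             refl B C ∣ a - b ∣ ∣ c - d ∣)
           (0≤+ (0≤* 0≤B (0≤∣p∣ (a - b))) (0≤* 0≤C (0≤∣p∣ (c - d)))) ⟩
    (B + C) * (∣ a - b ∣ + ∣ c - d ∣) ∎
    where open ≤-Reasoning
  B = proj₁ (bounded x)
  C = proj₁ (bounded y)
  M = proj₁ (proj₂ (proj₂ (bounded x)))
  N = proj₁ (proj₂ (proj₂ (bounded y)))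
  1≤B : 1ℚ ≤ B
  1≤B = proj₁ (proj₂ (bounded x))
  0≤C : 0ℚ ≤ C
  0≤C = ≤-trans 0≤1 (proj₁ (proj₂ (bounded y)))
  isCauchy : IsCauchy (λ n → seq x n * seq y n)
  isCauchy = vanishing-dominated (B + C) (0<+ (<-≤-trans 0<1 1≤B) 0≤C)
    (vanishing-+ (cauchy x) (cauchy y))
    (M ℕ.⊔ N , λ m n g g′ →
      bound (seq x m) (seq x n) (seq y m) (seq y n) (≤-trans 0≤1 1≤B) 0≤C
        (proj₂ (proj₂ (proj₂ (bounded x))) m (ℕP.m⊔n≤o⇒m≤o M N g))
        (proj₂ (proj₂ (proj₂ (bounded y))) n (ℕP.m⊔n≤o⇒n≤o M N g′)))

0<ᴿ⇒ : ∀ {x} → 0ᴿ <ᴿ x → ∃ λ δ → 0ℚ < δ × ∃ λ N → ∀ n → N ℕ.≤ n → δ ≤ seq x n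
0<ᴿ⇒ {x} (δ , 0<δ , N , h) =
  δ , 0<δ , N , λ n N≤n → ≤-trans (≤-reflexive (sym (+-identityˡ δ))) (h n N≤n)

recipᴿ : (x : ℝ) → 0ᴿ <ᴿ x → ℝ
recipᴿ x 0<x = mkℝ (λ n → recip (seq x n)) isCauchy
  where
  bound : ∀ {δ} a b → 0ℚ < δ → δ ≤ a → δ ≤ b →
          ∣ recip a - recip b ∣ ≤ recip δ * recip δ * ∣ a - b ∣
  bound {δ} a b 0<δ δ≤a δ≤b = begin
    ∣ r - s ∣                ≡⟨ cong ∣_∣ eq ⟩
    ∣ r * s * (b - a) ∣      ≡⟨ ∣p*q∣≡∣p∣*∣q∣ (r * s) (b - a) ⟩
    ∣ r * s ∣ * ∣ b - a ∣    ≡⟨ cong₂ _*_ (0≤p⇒∣p∣≡p (0≤* 0≤r 0≤s)) (∣-∣-sym b a) ⟩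
    r * s * ∣ a - b ∣        ≤⟨ *-mono (0≤* 0≤r 0≤s)
                                 (*-mono 0≤r (recip-antimono 0<δ δ≤a) 0≤s (recip-antimono 0<δ δ≤b))
                                 (0≤∣p∣ (a - b)) ≤-refl ⟩
    recip δ * recip δ * ∣ a - b ∣ ∎
    where
    r = recip a
    s = recip b
    0<a = <-≤-trans 0<δ δ≤a
    0<b = <-≤-trans 0<δ δ≤b
    0≤r = <⇒≤ (0<recip 0<a)
    0≤s = <⇒≤ (0<recip 0<b)
    eq : r - s ≡ r * s * (b - a)
    eq = trans (solve 2 (λ r s → r :- s := r :* con 1ℚ :- con 1ℚ :* s) refl r s)
      (trans (cong₂ (λ u v → r * u - v * s) (sym (*-recip 0<b)) (sym (*-recip 0<a)))
        (solve 4 (λ a b r s → r :* (b :* s) :- a :* r :* s := r :* s :* (b :- a)) refl a b r s))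
    open ≤-Reasoning
  δ = proj₁ (0<ᴿ⇒ {x} 0<x)
  0<δ : 0ℚ < δ
  0<δ = proj₁ (proj₂ (0<ᴿ⇒ {x} 0<x))
  isCauchy : IsCauchy (λ n → recip (seq x n))
  isCauchy = vanishing-dominated (recip δ * recip δ) (0<* (0<recip 0<δ) (0<recip 0<δ)) (cauchy x)
    (proj₁ (proj₂ (proj₂ (0<ᴿ⇒ {x} 0<x))) , λ m n N≤m N≤n →
      bound (seq x m) (seq x n) 0<δ (proj₂ (proj₂ (proj₂ (0<ᴿ⇒ {x} 0<x))) m N≤m)
                                    (proj₂ (proj₂ (proj₂ (0<ᴿ⇒ {x} 0<x))) n N≤n))

_/ᴿ_⟨_⟩ : (x y : ℝ) → 0ᴿ <ᴿ y → ℝ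
x /ᴿ y ⟨ 0<y ⟩ = x *ᴿ recipᴿ y 0<y

private
  square-mono : ∀ {p q} → 0ℚ ≤ p → p ≤ q → p * p ≤ q * q
  square-mono 0≤p p≤q = *-mono 0≤p p≤q 0≤p p≤q

-- The largest of 0, e, 2e, …, be whose square is at most q (0 if there is none).
gridRoot : ℚ → ℚ → ℕ → ℚ
gridRoot e q zero = 0ℚ
gridRoot e q (suc b) with (ι (suc b) * e) * (ι (suc b) * e) ≤? q
... | yes _ = ι (suc b) * e
... | no  _ = gridRoot e q b

-- The bound on the grid exceeds the square root of q, so that √ℚ n q is
-- within 1/(n+1) of it; negative q are sent to 0.
√ℚ : ℕ → ℚ → ℚ
√ℚ n q = gridRoot (ε n) q (suc ℤ.∣ ↥ q ∣ ℕ.* suc n)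

gridRoot-nonNeg : ∀ e q b → 0ℚ ≤ e → 0ℚ ≤ gridRoot e q b
gridRoot-nonNeg e q zero    0≤e = ≤-refl
gridRoot-nonNeg e q (suc b) 0≤e with (ι (suc b) * e) * (ι (suc b) * e) ≤? q
... | yes _ = 0≤* (0≤ι (suc b)) 0≤e
... | no  _ = gridRoot-nonNeg e q b 0≤e

gridRoot-lower : ∀ e q b → gridRoot e q b ≡ 0ℚ ⊎ gridRoot e q b * gridRoot e q b ≤ q
gridRoot-lower e q zero    = inj₁ refl
gridRoot-lower e q (suc b) with (ι (suc b) * e) * (ι (suc b) * e) ≤? q
... | yes h = inj₂ h
... | no  _ = gridRoot-lower e q b

gridRoot-upper : ∀ e q b → q < (ι (suc b) * e) * (ι (suc b) * e) →
                 q < (gridRoot e q b + e) * (gridRoot e q b + e)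
gridRoot-upper e q zero h = subst (λ t → q < t * t)
  (solve 1 (λ e → con 1ℚ :* e := con 0ℚ :+ e) refl e) h
gridRoot-upper e q (suc b) h with (ι (suc b) * e) * (ι (suc b) * e) ≤? q
... | yes _  = subst (λ t → q < t * t)
  (trans (cong (_* e) (ι-suc (suc b)))
    (solve 2 (λ i e → (con 1ℚ :+ i) :* e := i :* e :+ e) refl (ι (suc b)) e)) h
... | no  ≰q = gridRoot-upper e q b (≰⇒> ≰q)

√ℚ-nonNeg : ∀ n q → 0ℚ ≤ √ℚ n q
√ℚ-nonNeg n q = gridRoot-nonNeg (ε n) q (suc ℤ.∣ ↥ q ∣ ℕ.* suc n) (<⇒≤ (0<ε n))

√ℚ-lower : ∀ n q → √ℚ n q ≡ 0ℚ ⊎ √ℚ n q * √ℚ n q ≤ q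
√ℚ-lower n q = gridRoot-lower (ε n) q (suc ℤ.∣ ↥ q ∣ ℕ.* suc n)

√ℚ-upper : ∀ n q → q < (√ℚ n q + ε n) * (√ℚ n q + ε n)
√ℚ-upper n q = gridRoot-upper (ε n) q b (<-≤-trans q<a² (square-mono 0≤a a≤top))
  where
  a b : _
  a = suc ℤ.∣ ↥ q ∣
  b = a ℕ.* suc n
  0≤a : 0ℚ ≤ ι a
  0≤a = 0≤ι a
  q<a² : q < ι a * ι a
  q<a² = ≤-<-trans (p≤ι∣↥p∣ q) (<-≤-trans
    (subst₂ _<_ (+-identityˡ _) (sym (ι-suc ℤ.∣ ↥ q ∣)) (+-monoˡ-< (ι ℤ.∣ ↥ q ∣) 0<1))
    (subst (_≤ ι a * ι a) (*-identityʳ (ι a)) (*-monoˡ 0≤a (1≤ιsuc ℤ.∣ ↥ q ∣))))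
  a≤top : ι a ≤ ι (suc b) * ε n
  a≤top = subst (_≤ ι (suc b) * ε n) a≡
    (*-mono (0≤ι b) (ι-mono (ℕP.n≤1+n b)) (<⇒≤ (0<ε n)) ≤-refl)
    where
    open ≡-Reasoning
    a≡ : ι b * ε n ≡ ι a
    a≡ = begin
      ι b * ε n                 ≡⟨ cong (_* ε n) (ι-* a (suc n)) ⟩
      ι a * ι (suc n) * ε n     ≡⟨ *-assoc (ι a) (ι (suc n)) (ε n) ⟩
      ι a * (ι (suc n) * ε n)   ≡⟨ cong (ι a *_) (*-recip (0<ιsuc n)) ⟩
      ι a * 1ℚ                  ≡⟨ *-identityʳ (ι a) ⟩
      ι a                       ∎

√ᴿ : ℝ → ℝ
√ᴿ x = mkℝ (λ n → √ℚ n (seq x n)) isCauchy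
  where
  oneSided : ∀ {η s p t e q} → 0ℚ < η → 0ℚ ≤ t → 0ℚ ≤ e → e ≤ η * ½ → p - q ≤ (η * ½) * (η * ½) →
             s ≡ 0ℚ ⊎ s * s ≤ p → q < (t + e) * (t + e) → s - t ≤ η
  oneSided {η} {s} {p} {t} {e} {q} 0<η 0≤t 0≤e e≤h p-q≤h² lower upper with s - t ≤? η
  ... | yes s-t≤η = s-t≤η
  ... | no  s-t≰η = contradiction (<-≤-trans q<u² (≤-trans u²≤s²-h² (s²-h²≤q lower))) (<-irrefl refl)
    where
    h = η * ½
    u = t + e
    0≤h : 0ℚ ≤ h
    0≤h = <⇒≤ (0<* 0<η 0<½)
    0≤u : 0ℚ ≤ u
    0≤u = 0≤+ 0≤t 0≤e
    q<u² : q < u * u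
    q<u² = upper
    t+η≤s : t + η ≤ s
    t+η≤s = ≤-by ((s - t) - η)
      (solve 3 (λ s t η → s := t :+ η :+ ((s :- t) :- η)) refl s t η)
      (≤⇒0≤- (<⇒≤ (≰⇒> s-t≰η)))
    u+h≤s : u + h ≤ s
    u+h≤s = ≤-trans (≤-by (h - e)
      (trans (cong (t +_) (sym (half+half η)))
        (solve 3 (λ t e h → t :+ (h :+ h) := t :+ e :+ h :+ (h :- e)) refl t e h))
      (≤⇒0≤- e≤h)) t+η≤s
    u²≤s²-h² : u * u ≤ s * s - h * h
    u²≤s²-h² = ≤-by ((s * s - (u + h) * (u + h)) + (u * h + u * h))
      (solve 3 (λ s u h → s :* s :- h :* h
                       := u :* u :+ ((s :* s :- (u :+ h) :* (u :+ h)) :+ (u :* h :+ u :* h))) refl s u h)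
      (0≤+ (≤⇒0≤- (square-mono (0≤+ 0≤u 0≤h) u+h≤s)) (0≤+ (0≤* 0≤u 0≤h) (0≤* 0≤u 0≤h)))
    0<s : 0ℚ < s
    0<s = <-≤-trans (subst (_< t + η) (+-identityʳ 0ℚ) (+-mono-≤-< 0≤t 0<η)) t+η≤s
    s²-h²≤q : s ≡ 0ℚ ⊎ s * s ≤ p → s * s - h * h ≤ q
    s²-h²≤q (inj₁ s≡0)  = contradiction (sym s≡0) (<⇒≢ 0<s)
    s²-h²≤q (inj₂ s²≤p) = ≤-by ((p - s * s) + (h * h - (p - q)))
      (solve 4 (λ p q a b → q := a :- b :+ ((p :- a) :+ (b :- (p :- q)))) refl p q (s * s) (h * h))
      (0≤+ (≤⇒0≤- s²≤p) (≤⇒0≤- p-q≤h²))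

  isCauchy : IsCauchy (λ n → √ℚ n (seq x n))
  isCauchy η 0<η = M ℕ.⊔ N , λ m n g g′ →
    ∣-∣≤ (√ℚ m (seq x m)) (√ℚ n (seq x n))
         (close (ℕP.m⊔n≤o⇒m≤o M N g) (ℕP.m⊔n≤o⇒m≤o M N g′) (ℕP.m⊔n≤o⇒n≤o M N g′))
         (close (ℕP.m⊔n≤o⇒m≤o M N g′) (ℕP.m⊔n≤o⇒m≤o M N g) (ℕP.m⊔n≤o⇒n≤o M N g))
    where
    0<h : 0ℚ < η * ½
    0<h = 0<* 0<η 0<½
    closeX = cauchy x ((η * ½) * (η * ½)) (0<* 0<h 0<h)
    closeε = archimedean 0<h
    M = proj₁ closeX
    N = proj₁ closeε
    close : ∀ {m n} → M ℕ.≤ m → M ℕ.≤ n → N ℕ.≤ n → √ℚ m (seq x m) - √ℚ n (seq x n) ≤ η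
    close {m} {n} M≤m M≤n N≤n = oneSided 0<η (√ℚ-nonNeg n (seq x n)) (<⇒≤ (0<ε n))
      (proj₂ closeε n N≤n)
      (≤-trans (p≤∣p∣ (seq x m - seq x n)) (proj₂ closeX m n M≤m M≤n))
      (√ℚ-lower m (seq x m)) (√ℚ-upper n (seq x n))

sumTo : ℕ → (ℕ → ℚ) → ℚ
sumTo zero    f = 0ℚ
sumTo (suc n) f = sumTo n f + f n

artanhTerm : ℚ → ℕ → ℚ
artanhTerm z k = z ^ suc (2 ℕ.* k) * recip (ι (suc (2 ℕ.* k)))

artanhPartial : ℕ → ℚ → ℚ
artanhPartial n z = sumTo n (artanhTerm z)

module Geometric {η : ℚ} (0<η : 0ℚ < η) (η≤1 : η ≤ 1ℚ) where

  ρ : ℚ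
  ρ = 1ℚ - η

  0≤ρ : 0ℚ ≤ ρ
  0≤ρ = ≤⇒0≤- η≤1

  ρ≤1 : ρ ≤ 1ℚ
  ρ≤1 = ≤-by η (solve 1 (λ η → con 1ℚ := con 1ℚ :- η :+ η) refl η) (<⇒≤ 0<η)

  0≤ρ^ : ∀ k → 0ℚ ≤ ρ ^ k
  0≤ρ^ zero    = 0≤1
  0≤ρ^ (suc k) = 0≤* 0≤ρ (0≤ρ^ k)

  ρ^-step : ∀ k → ρ ^ suc k ≤ ρ ^ k
  ρ^-step k = subst (ρ * ρ ^ k ≤_) (*-identityˡ (ρ ^ k)) (*-mono 0≤ρ ρ≤1 (0≤ρ^ k) ≤-refl)

  ρ^-antimono : ∀ {j k} → j ℕ.≤ k → ρ ^ k ≤ ρ ^ j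
  ρ^-antimono {zero} {zero}   _           = ≤-refl
  ρ^-antimono {zero} {suc k}  _           = ≤-trans (ρ^-step k) (ρ^-antimono {zero} {k} ℕ.z≤n)
  ρ^-antimono {suc j} {suc k} (ℕ.s≤s j≤k) = *-monoˡ 0≤ρ (ρ^-antimono j≤k)

  ∣^∣≤ : ∀ {z} → ∣ z ∣ ≤ ρ → ∀ k → ∣ z ^ k ∣ ≤ ρ ^ k
  ∣^∣≤ z≤ρ zero    = ≤-refl
  ∣^∣≤ {z} z≤ρ (suc k) = ≤-trans (≤-reflexive (∣p*q∣≡∣p∣*∣q∣ z (z ^ k)))
    (*-mono (0≤∣p∣ z) z≤ρ (0≤∣p∣ (z ^ k)) (∣^∣≤ z≤ρ k))

  divide : ∀ {a b} → η * a ≤ b → a ≤ recip η * b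
  divide {a} {b} h = subst (_≤ recip η * b) eq (*-monoˡ (<⇒≤ (0<recip 0<η)) h)
    where
    open ≡-Reasoning
    eq : recip η * (η * a) ≡ a
    eq = begin
      recip η * (η * a)  ≡⟨ solve 3 (λ r η a → r :* (η :* a) := η :* r :* a) refl (recip η) η a ⟩
      η * recip η * a    ≡⟨ cong (_* a) (*-recip 0<η) ⟩
      1ℚ * a             ≡⟨ *-identityˡ a ⟩
      a                  ∎

  bernoulli : ∀ n → ρ ^ n * (1ℚ + ι n * η) ≤ 1ℚ
  bernoulli zero    = ≤-reflexive (trans (*-identityˡ _)
    (solve 1 (λ η → con 1ℚ :+ con 0ℚ :* η := con 1ℚ) refl η))
  bernoulli (suc n) = ≤-trans (≤-by (ρ ^ n * ((1ℚ + ι n) * (η * η)))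
    (trans (solve 3 (λ r i η → r :* (con 1ℚ :+ i :* η)
                   := (con 1ℚ :- η) :* r :* (con 1ℚ :+ (con 1ℚ :+ i) :* η)
                      :+ r :* ((con 1ℚ :+ i) :* (η :* η))) refl (ρ ^ n) (ι n) η)
           (cong (λ i → ρ ^ suc n * (1ℚ + i * η) + ρ ^ n * ((1ℚ + ι n) * (η * η))) (sym (ι-suc n))))
    (0≤* (0≤ρ^ n) (0≤* (0≤+ 0≤1 (0≤ι n)) (0≤* (<⇒≤ 0<η) (<⇒≤ 0<η))))) (bernoulli n)

  ρ^≤ : ∀ n → ρ ^ n ≤ recip η * ε n
  ρ^≤ n = divide (subst (_≤ ε n) eq
    (subst (ε n * (η * (ι (suc n) * ρ ^ n)) ≤_) (*-identityʳ (ε n)) (*-monoˡ (<⇒≤ (0<ε n)) small)))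
    where
    open ≡-Reasoning
    small : η * (ι (suc n) * ρ ^ n) ≤ 1ℚ
    small = ≤-trans (≤-by (ρ ^ n * (1ℚ - η))
      (trans (solve 3 (λ r i η → r :* (con 1ℚ :+ i :* η)
                     := η :* ((con 1ℚ :+ i) :* r) :+ r :* (con 1ℚ :- η)) refl (ρ ^ n) (ι n) η)
             (cong (λ i → η * (i * ρ ^ n) + ρ ^ n * (1ℚ - η)) (sym (ι-suc n))))
      (0≤* (0≤ρ^ n) 0≤ρ)) (bernoulli n)
    eq : ε n * (η * (ι (suc n) * ρ ^ n)) ≡ η * ρ ^ n
    eq = begin
      ε n * (η * (ι (suc n) * ρ ^ n))
        ≡⟨ solve 4 (λ e η i r → e :* (η :* (i :* r)) := i :* e :* (η :* r)) refl (ε n) η (ι (suc n)) (ρ ^ n) ⟩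
      ι (suc n) * ε n * (η * ρ ^ n)  ≡⟨ cong (_* (η * ρ ^ n)) (*-recip (0<ιsuc n)) ⟩
      1ℚ * (η * ρ ^ n)               ≡⟨ *-identityˡ _ ⟩
      η * ρ ^ n                      ∎

  recip-ι≤1 : ∀ n → recip (ι (suc n)) ≤ 1ℚ
  recip-ι≤1 n = subst (recip (ι (suc n)) ≤_) refl (recip-antimono 0<1 (1≤ιsuc n))

  k≤2k : ∀ k → k ℕ.≤ 2 ℕ.* k
  k≤2k k = ℕP.m≤m+n k (k ℕ.+ 0)

  ∣term∣≤ : ∀ {z} → ∣ z ∣ ≤ ρ → ∀ k → ∣ artanhTerm z k ∣ ≤ ρ ^ k
  ∣term∣≤ {z} z≤ρ k = begin
    ∣ z ^ suc 2k * recip (ι (suc 2k)) ∣      ≡⟨ ∣p*q∣≡∣p∣*∣q∣ (z ^ suc 2k) (recip (ι (suc 2k))) ⟩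
    ∣ z ^ suc 2k ∣ * ∣ recip (ι (suc 2k)) ∣  ≡⟨ cong (∣ z ^ suc 2k ∣ *_) (0≤p⇒∣p∣≡p (<⇒≤ (0<ε 2k))) ⟩
    ∣ z ^ suc 2k ∣ * recip (ι (suc 2k))      ≤⟨ *-mono (0≤∣p∣ (z ^ suc 2k)) (∣^∣≤ z≤ρ (suc 2k))
                                                       (<⇒≤ (0<ε 2k)) (recip-ι≤1 2k) ⟩
    ρ ^ suc 2k * 1ℚ                          ≡⟨ *-identityʳ _ ⟩
    ρ ^ suc 2k                               ≤⟨ ρ^-antimono (ℕP.≤-trans (k≤2k k) (ℕP.n≤1+n 2k)) ⟩
    ρ ^ k                                    ∎
    where
    open ≤-Reasoning
    2k = 2 ℕ.* k

  tail : ∀ {z} → ∣ z ∣ ≤ ρ → ∀ j n →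
         η * ∣ artanhPartial (j ℕ.+ n) z - artanhPartial n z ∣ ≤ ρ ^ n - ρ ^ (j ℕ.+ n)
  tail {z} z≤ρ zero n = ≤-reflexive (trans
    (cong (λ t → η * ∣ t ∣) (+-inverseʳ (artanhPartial n z)))
    (trans (*-zeroʳ η) (sym (+-inverseʳ (ρ ^ n)))))
  tail {z} z≤ρ (suc j) n = begin
    η * ∣ S + t - S₀ ∣
      ≡⟨ cong (λ a → η * ∣ a ∣) (solve 3 (λ S t S₀ → S :+ t :- S₀ := S :- S₀ :+ t) refl S t S₀) ⟩
    η * ∣ (S - S₀) + t ∣                ≤⟨ *-monoˡ (<⇒≤ 0<η) (∣p+q∣≤∣p∣+∣q∣ (S - S₀) t) ⟩
    η * (∣ S - S₀ ∣ + ∣ t ∣)            ≡⟨ *-distribˡ-+ η ∣ S - S₀ ∣ ∣ t ∣ ⟩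
    η * ∣ S - S₀ ∣ + η * ∣ t ∣          ≤⟨ +-mono-≤ (tail z≤ρ j n)
                                            (*-monoˡ (<⇒≤ 0<η) (∣term∣≤ z≤ρ (j ℕ.+ n))) ⟩
    ρ ^ n - r + η * r
      ≡⟨ solve 3 (λ a r η → a :- r :+ η :* r := a :- (con 1ℚ :- η) :* r) refl (ρ ^ n) r η ⟩
    ρ ^ n - ρ ^ suc (j ℕ.+ n)           ∎
    where
    open ≤-Reasoning
    S  = artanhPartial (j ℕ.+ n) z
    S₀ = artanhPartial n z
    t  = artanhTerm z (j ℕ.+ n)
    r  = ρ ^ (j ℕ.+ n)

  tail≤ε : ∀ {z} → ∣ z ∣ ≤ ρ → ∀ {m n} → n ℕ.≤ m →
           ∣ artanhPartial m z - artanhPartial n z ∣ ≤ recip η * (recip η * ε n)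
  tail≤ε {z} z≤ρ {m} {n} n≤m = divide (≤-trans
    (subst (λ m → η * ∣ artanhPartial m z - artanhPartial n z ∣ ≤ ρ ^ n - ρ ^ m)
           (ℕP.m∸n+n≡m n≤m) (tail z≤ρ (m ℕ.∸ n) n))
    (≤-trans (≤-by (ρ ^ m) (solve 2 (λ a b → a := a :- b :+ b) refl (ρ ^ n) (ρ ^ m)) (0≤ρ^ m)) (ρ^≤ n)))

  powerDifference : ∀ {z w} → ∣ z ∣ ≤ ρ → ∣ w ∣ ≤ ρ → ∀ k →
                    ∣ z ^ suc k - w ^ suc k ∣ ≤ ι (suc k) * (ρ ^ k * ∣ z - w ∣)
  powerDifference {z} {w} z≤ρ w≤ρ zero = ≤-reflexive (trans
    (cong ∣_∣ (solve 2 (λ z w → z :* con 1ℚ :- w :* con 1ℚ := z :- w) refl z w))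
    (solve 1 (λ d → d := con 1ℚ :* (con 1ℚ :* d)) refl ∣ z - w ∣))
  powerDifference {z} {w} z≤ρ w≤ρ (suc k) = begin
    ∣ z * a - w * b ∣
      ≡⟨ cong ∣_∣ (solve 4 (λ z w a b → z :* a :- w :* b := z :* (a :- b) :+ b :* (z :- w)) refl z w a b) ⟩
    ∣ z * (a - b) + b * (z - w) ∣          ≤⟨ ∣p+q∣≤∣p∣+∣q∣ (z * (a - b)) (b * (z - w)) ⟩
    ∣ z * (a - b) ∣ + ∣ b * (z - w) ∣      ≡⟨ cong₂ _+_ (∣p*q∣≡∣p∣*∣q∣ z (a - b)) (∣p*q∣≡∣p∣*∣q∣ b (z - w)) ⟩
    ∣ z ∣ * ∣ a - b ∣ + ∣ b ∣ * d
      ≤⟨ +-mono-≤ (*-mono (0≤∣p∣ z) z≤ρ (0≤∣p∣ (a - b)) (powerDifference z≤ρ w≤ρ k))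
                  (*-mono (0≤∣p∣ b) (∣^∣≤ w≤ρ (suc k)) (0≤∣p∣ (z - w)) ≤-refl) ⟩
    ρ * (ι (suc k) * (ρ ^ k * d)) + ρ * ρ ^ k * d
      ≡⟨ solve 4 (λ r i p d → r :* (i :* (p :* d)) :+ r :* p :* d := (con 1ℚ :+ i) :* (r :* p :* d))
           refl ρ (ι (suc k)) (ρ ^ k) d ⟩
    (1ℚ + ι (suc k)) * (ρ * ρ ^ k * d)     ≡⟨ cong (_* (ρ * ρ ^ k * d)) (ι-suc (suc k)) ⟨
    ι (suc (suc k)) * (ρ * ρ ^ k * d)      ∎
    where
    open ≤-Reasoning
    a = z ^ suc k
    b = w ^ suc k
    d = ∣ z - w ∣

  termDifference : ∀ {z w} → ∣ z ∣ ≤ ρ → ∣ w ∣ ≤ ρ → ∀ k →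
                   ∣ artanhTerm z k - artanhTerm w k ∣ ≤ ρ ^ k * ∣ z - w ∣
  termDifference {z} {w} z≤ρ w≤ρ k = begin
    ∣ a * r - b * r ∣
      ≡⟨ cong ∣_∣ (solve 3 (λ a b r → a :* r :- b :* r := (a :- b) :* r) refl a b r) ⟩
    ∣ (a - b) * r ∣                        ≡⟨ ∣p*q∣≡∣p∣*∣q∣ (a - b) r ⟩
    ∣ a - b ∣ * ∣ r ∣                      ≡⟨ cong (∣ a - b ∣ *_) (0≤p⇒∣p∣≡p (<⇒≤ (0<ε 2k))) ⟩
    ∣ a - b ∣ * r                          ≤⟨ *-mono (0≤∣p∣ (a - b)) (powerDifference z≤ρ w≤ρ 2k)
                                                     (<⇒≤ (0<ε 2k)) ≤-refl ⟩
    ι (suc 2k) * (ρ ^ 2k * d) * r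
      ≡⟨ solve 3 (λ i p r → i :* p :* r := i :* r :* p) refl (ι (suc 2k)) (ρ ^ 2k * d) r ⟩
    ι (suc 2k) * r * (ρ ^ 2k * d)          ≡⟨ cong (_* (ρ ^ 2k * d)) (*-recip (0<ιsuc 2k)) ⟩
    1ℚ * (ρ ^ 2k * d)                      ≡⟨ *-identityˡ _ ⟩
    ρ ^ 2k * d                             ≤⟨ *-mono (0≤ρ^ 2k) (ρ^-antimono (k≤2k k)) (0≤∣p∣ (z - w)) ≤-refl ⟩
    ρ ^ k * d                              ∎
    where
    open ≤-Reasoning
    2k = 2 ℕ.* k
    a = z ^ suc 2k
    b = w ^ suc 2k
    r = recip (ι (suc 2k))
    d = ∣ z - w ∣

  lipschitz′ : ∀ {z w} → ∣ z ∣ ≤ ρ → ∣ w ∣ ≤ ρ → ∀ n →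
               η * ∣ artanhPartial n z - artanhPartial n w ∣ ≤ (1ℚ - ρ ^ n) * ∣ z - w ∣
  lipschitz′ {z} {w} z≤ρ w≤ρ zero = ≤-reflexive
    (trans (*-zeroʳ η) (sym (*-zeroˡ ∣ z - w ∣)))
  lipschitz′ {z} {w} z≤ρ w≤ρ (suc n) = begin
    η * ∣ S + s - (T + t) ∣
      ≡⟨ cong (λ a → η * ∣ a ∣)
           (solve 4 (λ S s T t → S :+ s :- (T :+ t) := S :- T :+ (s :- t)) refl S s T t) ⟩
    η * ∣ (S - T) + (s - t) ∣             ≤⟨ *-monoˡ (<⇒≤ 0<η) (∣p+q∣≤∣p∣+∣q∣ (S - T) (s - t)) ⟩
    η * (∣ S - T ∣ + ∣ s - t ∣)           ≡⟨ *-distribˡ-+ η ∣ S - T ∣ ∣ s - t ∣ ⟩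
    η * ∣ S - T ∣ + η * ∣ s - t ∣         ≤⟨ +-mono-≤ (lipschitz′ z≤ρ w≤ρ n)
                                              (*-monoˡ (<⇒≤ 0<η) (termDifference z≤ρ w≤ρ n)) ⟩
    (1ℚ - r) * d + η * (r * d)
      ≡⟨ solve 3 (λ r d η → (con 1ℚ :- r) :* d :+ η :* (r :* d) := (con 1ℚ :- (con 1ℚ :- η) :* r) :* d)
           refl r d η ⟩
    (1ℚ - ρ ^ suc n) * d                  ∎
    where
    open ≤-Reasoning
    S = artanhPartial n z
    T = artanhPartial n w
    s = artanhTerm z n
    t = artanhTerm w n
    r = ρ ^ n
    d = ∣ z - w ∣

  lipschitz : ∀ {z w} → ∣ z ∣ ≤ ρ → ∣ w ∣ ≤ ρ → ∀ n →
              ∣ artanhPartial n z - artanhPartial n w ∣ ≤ recip η * (recip η * ∣ z - w ∣)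
  lipschitz {z} {w} z≤ρ w≤ρ n = divide (≤-trans (lipschitz′ z≤ρ w≤ρ n) (≤-trans
    (≤-by (ρ ^ n * d) (solve 2 (λ r d → d := (con 1ℚ :- r) :* d :+ r :* d) refl (ρ ^ n) d)
      (0≤* (0≤ρ^ n) (0≤∣p∣ (z - w))))
    (divide (subst (η * d ≤_) (*-identityˡ d) (*-mono (<⇒≤ 0<η) η≤1 (0≤∣p∣ (z - w)) ≤-refl)))))
    where d = ∣ z - w ∣

  close : ∀ {z w} → ∣ z ∣ ≤ ρ → ∣ w ∣ ≤ ρ → ∀ m n →
          ∣ artanhPartial m z - artanhPartial n w ∣ ≤ recip η * recip η * ((ε m + ε n) + ∣ z - w ∣)
  close {z} {w} z≤ρ w≤ρ m n = begin
    ∣ artanhPartial m z - artanhPartial n w ∣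
      ≡⟨ cong ∣_∣ (solve 3 (λ a b c → a :- c := (a :- b) :+ (b :- c)) refl
           (artanhPartial m z) (artanhPartial n z) (artanhPartial n w)) ⟩
    ∣ (artanhPartial m z - artanhPartial n z) + (artanhPartial n z - artanhPartial n w) ∣
      ≤⟨ ∣p+q∣≤∣p∣+∣q∣ (artanhPartial m z - artanhPartial n z) (artanhPartial n z - artanhPartial n w) ⟩
    ∣ artanhPartial m z - artanhPartial n z ∣ + ∣ artanhPartial n z - artanhPartial n w ∣
      ≤⟨ +-mono-≤ (vary (ℕP.≤-total n m)) (lipschitz z≤ρ w≤ρ n) ⟩
    r * (r * (ε m + ε n)) + r * (r * ∣ z - w ∣)
      ≡⟨ solve 3 (λ r a b → r :* (r :* a) :+ r :* (r :* b) := r :* r :* (a :+ b)) refl r (ε m + ε n) ∣ z - w ∣ ⟩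
    r * r * ((ε m + ε n) + ∣ z - w ∣) ∎
    where
    open ≤-Reasoning
    r = recip η
    0≤r : 0ℚ ≤ r
    0≤r = <⇒≤ (0<recip 0<η)
    vary : n ℕ.≤ m ⊎ m ℕ.≤ n → ∣ artanhPartial m z - artanhPartial n z ∣ ≤ r * (r * (ε m + ε n))
    vary (inj₁ n≤m) = ≤-trans (tail≤ε z≤ρ n≤m) (*-monoˡ 0≤r (*-monoˡ 0≤r
      (≤-by (ε m) (+-comm (ε m) (ε n)) (<⇒≤ (0<ε m)))))
    vary (inj₂ m≤n) = ≤-trans (≤-reflexive (∣-∣-sym (artanhPartial m z) (artanhPartial n z)))
      (≤-trans (tail≤ε z≤ρ m≤n) (*-monoˡ 0≤r (*-monoˡ 0≤r (≤-by (ε n) refl (<⇒≤ (0<ε n))))))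

-- artanh z = z + z³/3 + z⁵/5 + …
artanhᴿ : (z : ℝ) → -ᴿ 1ᴿ <ᴿ z → z <ᴿ 1ᴿ → ℝ
artanhᴿ z (δ , 0<δ , M , lower) (δ′ , 0<δ′ , N , upper) =
  mkℝ (λ n → artanhPartial n (seq z n))
    (vanishing-dominated (recip η * recip η) (0<* (0<recip 0<η) (0<recip 0<η))
      (vanishing-+ vanishing-ε (cauchy z))
      (M ℕ.⊔ N , λ m n g g′ → close (inside m g) (inside n g′) m n))
  where
  η : ℚ
  η = (δ ⊓ δ′) ⊓ 1ℚ
  0<η : 0ℚ < η
  0<η = ⊓-pos (⊓-pos 0<δ 0<δ′) 0<1
  open Geometric 0<η (p⊓q≤q (δ ⊓ δ′) 1ℚ)
  η≤δ : η ≤ δ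
  η≤δ = ≤-trans (p⊓q≤p (δ ⊓ δ′) 1ℚ) (p⊓q≤p δ δ′)
  η≤δ′ : η ≤ δ′
  η≤δ′ = ≤-trans (p⊓q≤p (δ ⊓ δ′) 1ℚ) (p⊓q≤q δ δ′)
  above : ∀ a → a + δ′ ≤ 1ℚ → a ≤ 1ℚ - η
  above a h = ≤-by ((1ℚ - (a + δ′)) + (δ′ - η))
    (solve 3 (λ a d η → con 1ℚ :- η := a :+ ((con 1ℚ :- (a :+ d)) :+ (d :- η))) refl a δ′ η)
    (0≤+ (≤⇒0≤- h) (≤⇒0≤- η≤δ′))
  below : ∀ a → - 1ℚ + δ ≤ a → - a ≤ 1ℚ - η
  below a h = ≤-by ((a - (- 1ℚ + δ)) + (δ - η))
    (solve 3 (λ a d η → con 1ℚ :- η := :- a :+ ((a :- (:- con 1ℚ :+ d)) :+ (d :- η))) refl a δ η)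
    (0≤+ (≤⇒0≤- h) (≤⇒0≤- η≤δ))
  inside : ∀ n → M ℕ.⊔ N ℕ.≤ n → ∣ seq z n ∣ ≤ 1ℚ - η
  inside n g = ∣∣≤ (above (seq z n) (upper n (ℕP.m⊔n≤o⇒n≤o M N g)))
                   (below (seq z n) (lower n (ℕP.m⊔n≤o⇒m≤o M N g)))

0<x⇒0<x+1 : ∀ x → 0ᴿ <ᴿ x → 0ᴿ <ᴿ x +ᴿ 1ᴿ
0<x⇒0<x+1 x (δ , 0<δ , N , h) = δ , 0<δ , N , λ n N≤n →
  ≤-trans (h n N≤n) (≤-by 1ℚ refl 0≤1)

module Cayley (x : ℝ) (0<x : 0ᴿ <ᴿ x) where

  -- (x - 1)/(x + 1)
  cayley : ℝ
  cayley = (x -ᴿ 1ᴿ) /ᴿ (x +ᴿ 1ᴿ) ⟨ 0<x⇒0<x+1 x 0<x ⟩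

  private
    δ B η : ℚ
    δ = proj₁ (0<ᴿ⇒ {x} 0<x) ⊓ 1ℚ
    B = proj₁ (bounded x) + 1ℚ
    η = δ * recip B
    M N : ℕ
    M = proj₁ (proj₂ (proj₂ (0<ᴿ⇒ {x} 0<x)))
    N = proj₁ (proj₂ (proj₂ (bounded x)))
    0<δ : 0ℚ < δ
    0<δ = ⊓-pos (proj₁ (proj₂ (0<ᴿ⇒ {x} 0<x))) 0<1
    0<B : 0ℚ < B
    0<B = 0<+ (<-≤-trans 0<1 (proj₁ (proj₂ (bounded x)))) 0≤1
    0<η : 0ℚ < η
    0<η = 0<* 0<δ (0<recip 0<B)

    module _ (n : ℕ) (g : M ℕ.⊔ N ℕ.≤ n) where
      a u : ℚ
      a = seq x n
      u = recip (a + 1ℚ)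
      δ≤a : δ ≤ a
      δ≤a = ≤-trans (p⊓q≤p (proj₁ (0<ᴿ⇒ {x} 0<x)) 1ℚ) (proj₂ (proj₂ (proj₂ (0<ᴿ⇒ {x} 0<x))) n (ℕP.m⊔n≤o⇒m≤o M N g))
      0≤a : 0ℚ ≤ a
      0≤a = ≤-trans (<⇒≤ 0<δ) δ≤a
      a+1≤B : a + 1ℚ ≤ B
      a+1≤B = +-monoˡ-≤ 1ℚ
        (≤-trans (p≤∣p∣ a) (proj₂ (proj₂ (proj₂ (bounded x))) n (ℕP.m⊔n≤o⇒n≤o M N g)))
      0<a+1 : 0ℚ < a + 1ℚ
      0<a+1 = <-≤-trans 0<1 (≤-by a (+-comm a 1ℚ) 0≤a)
      0≤u : 0ℚ ≤ u
      0≤u = <⇒≤ (0<recip 0<a+1)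
      0≤v : 0ℚ ≤ recip B
      0≤v = <⇒≤ (0<recip 0<B)
      v≤u : recip B ≤ u
      v≤u = recip-antimono 0<a+1 a+1≤B
      η≤u : η ≤ u
      η≤u = subst (η ≤_) (*-identityˡ u) (*-mono (<⇒≤ 0<δ) (p⊓q≤q (proj₁ (0<ᴿ⇒ {x} 0<x)) 1ℚ) 0≤v v≤u)
      η≤au : η ≤ a * u
      η≤au = *-mono (<⇒≤ 0<δ) δ≤a 0≤v v≤u

      upper : (a - 1ℚ) * u + η ≤ 1ℚ
      upper = ≤-by (u + (u - η)) (trans (sym (*-recip 0<a+1))
        (solve 3 (λ a u η → (a :+ con 1ℚ) :* u
                         := (a :- con 1ℚ) :* u :+ η :+ (u :+ (u :- η))) refl a u η))
        (0≤+ 0≤u (≤⇒0≤- η≤u))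
      lower : - 1ℚ + η ≤ (a - 1ℚ) * u
      lower = ≤-by (a * u + (a * u - η))
        (trans (solve 3 (λ a u η → (a :- con 1ℚ) :* u
                         := :- ((a :+ con 1ℚ) :* u) :+ η :+ (a :* u :+ (a :* u :- η))) refl a u η)
          (cong (λ t → - t + η + (a * u + (a * u - η))) (*-recip 0<a+1)))
        (0≤+ (0≤* 0≤a 0≤u) (≤⇒0≤- η≤au))

  -1<cayley : -ᴿ 1ᴿ <ᴿ cayley
  -1<cayley = η , 0<η , M ℕ.⊔ N , lower

  cayley<1 : cayley <ᴿ 1ᴿ
  cayley<1 = η , 0<η , M ℕ.⊔ N , upper

-- log x = 2 artanh((x - 1)/(x + 1)), valid for every x > 0: if z = (x - 1)/(x + 1)
-- then |z| < 1, x = (1 + z)/(1 - z), and log((1 + z)/(1 - z)) = 2(z + z³/3 + z⁵/5 + …).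
logᴿ : (x : ℝ) → 0ᴿ <ᴿ x → ℝ
logᴿ x 0<x = fromℕ 2 *ᴿ artanhᴿ cayley -1<cayley cayley<1
  where open Cayley x 0<x

1≤x⇒0<x : ∀ x → 1ᴿ ≤ᴿ x → 0ᴿ <ᴿ x
1≤x⇒0<x x 1≤x = ½ , 0<½ , proj₁ (1≤x ½ 0<½) , λ n N≤n → bound (seq x n) (proj₂ (1≤x ½ 0<½) n N≤n)
  where
  bound : ∀ a → 1ℚ ≤ a + ½ → 0ℚ + ½ ≤ a
  bound a h = ≤-by ((a + ½) - 1ℚ)
    (solve 1 (λ a → a := con 0ℚ :+ con ½ :+ ((a :+ con ½) :- con 1ℚ)) refl a) (≤⇒0≤- h)

0<x⇒0<√x : ∀ x → 0ᴿ <ᴿ x → 0ᴿ <ᴿ √ᴿ x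
0<x⇒0<√x x 0<x = γ * ½ , 0<h , M ℕ.⊔ N , λ n g →
  subst (_≤ √ℚ n (seq x n)) (sym (+-identityˡ (γ * ½)))
    (≮⇒≥ (absurd (√ℚ-nonNeg n (seq x n)) (<⇒≤ (0<ε n))
      (proj₂ smallε n (ℕP.m⊔n≤o⇒n≤o M N g))
      (≤-trans (p⊓q≤p (proj₁ (0<ᴿ⇒ {x} 0<x)) 1ℚ) (proj₂ (proj₂ (proj₂ (0<ᴿ⇒ {x} 0<x))) n (ℕP.m⊔n≤o⇒m≤o M N g)))
      (√ℚ-upper n (seq x n))))
  where
  γ : ℚ
  γ = proj₁ (0<ᴿ⇒ {x} 0<x) ⊓ 1ℚ
  0<γ : 0ℚ < γ
  0<γ = ⊓-pos (proj₁ (proj₂ (0<ᴿ⇒ {x} 0<x))) 0<1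
  0<h : 0ℚ < γ * ½
  0<h = 0<* 0<γ 0<½
  smallε = archimedean 0<h
  M = proj₁ (proj₂ (proj₂ (0<ᴿ⇒ {x} 0<x)))
  N = proj₁ smallε
  absurd : ∀ {a s e} → 0ℚ ≤ s → 0ℚ ≤ e → e ≤ γ * ½ → γ ≤ a → a < (s + e) * (s + e) → s ≮ γ * ½
  absurd {a} {s} {e} 0≤s 0≤e e≤h γ≤a a<t² s<h = <-irrefl refl (<-≤-trans a<t²
    (≤-trans (*-mono 0≤t t≤γ 0≤t (≤-trans t≤γ (p⊓q≤q (proj₁ (0<ᴿ⇒ {x} 0<x)) 1ℚ)))
      (≤-trans (≤-reflexive (*-identityʳ γ)) γ≤a)))
    where
    0≤t : 0ℚ ≤ s + e
    0≤t = 0≤+ 0≤s 0≤e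
    t≤γ : s + e ≤ γ
    t≤γ = subst (s + e ≤_) (half+half γ) (+-mono-≤ (<⇒≤ s<h) e≤h)

-- The sum of the nonnegative family f over the index set P, an element of
-- [0,∞], is the supremum of its finite subsums; so it is at most B when
-- every finite subsum is.
infix 4 ∑[_]_≤ᴿ_

∑[_]_≤ᴿ_ : {I : Set} → (I → Set) → (I → ℚ) → ℝ → Set
∑[ P ] f ≤ᴿ B = ∀ is → Unique is → All P is → fromℚ (foldr _+_ 0ℚ (map f is)) ≤ᴿ B

Quadruple : Set
Quadruple = ℕ × ℕ × ℕ × ℕ

modulus : Quadruple → ℕ
modulus (r₁ , r₂ , d₁ , d₂) = lcm (r₁ ℕ.^ 2 ℕ.* d₁) (r₂ ℕ.^ 2 ℕ.* d₂)

CoprimeTo : ℤ → ℕ → Set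
CoprimeTo Δ r = gcd (ℤ.+ r) Δ ≡ 1ℤ

PrimeFactorsDivide : ℤ → ℕ → Set
PrimeFactorsDivide Δ d = ∀ q → Prime q → q ℕ∣.∣ d → ℤ.+ q ℤ∣.∣ Δ

InRange : ℤ → ℝ → Quadruple → Set
InRange Δ X i@(r₁ , r₂ , d₁ , d₂) =
  (1 ℕ.≤ r₁ × CoprimeTo Δ r₁) ×
  (1 ℕ.≤ r₂ × CoprimeTo Δ r₂) ×
  (1 ℕ.≤ d₁ × PrimeFactorsDivide Δ d₁) ×
  (1 ℕ.≤ d₂ × PrimeFactorsDivide Δ d₂) ×
  X ≤ᴿ fromℕ (modulus i)

-- The modulus is positive on the range of summation, so recip is 1/x there.
summand : Quadruple → ℚ
summand i = recip (ι (modulus i))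

{-# OPTIONS --safe #-}
-- Write r₁ = g a, r₂ = g b, d₁ = h x, d₂ = h y with a ⊥ b and x ⊥ y.  As the rᵢ are coprime to
-- the dⱼ, the modulus is n² D with n = g a b and D = h x y.  Encode g, a, b by their dyadic
-- blocks, of exponents e₁, e₂, e₃, and h, x, y by exponent vectors over the bases 2, …, ∣Δ∣ + 1.
-- If n² D ≥ 4^(t-1), then 1/(n² D) is at most a constant times 2^-t times a product of
-- 2^-(e₁ + e₂ + e₃), which cancels the number of integers in the three blocks, of powers of
-- σ = 7/8 that decay away from e₁ ≤ t, e₂ ≤ t and e₁ + e₂ + e₃ + 4 = t, and of σ to the sum of
-- all the exponents in h, x and y.  Summing over the codes gives O_Δ((t + 1)² 2^-t).  With
-- 4^t ≈ X this is the theorem: √X ≤ 2^(t+1), and the artanh series gives log X ≥ (t - 2)/4.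
module Submission where

open import Defs
open import Data.Nat.Base as ℕ using (ℕ; zero; suc; z≤n; s≤s)
import Data.Nat.Properties as ℕP
open import Data.Nat.Coprimality as Coprimality
  using (Coprime; coprime-divisor; coprime-/gcd; gcd≡1⇒coprime)
open import Data.Nat.Divisibility as ℕ∣ using (_∣_; divides)
open import Data.Nat.DivMod using (m/n*n≡m)
import Data.Nat.GCD as GCD
open import Data.Nat.LCM using (lcm-least; m∣lcm[m,n]; n∣lcm[m,n])
open import Data.Nat.ListAction using (product)
open import Data.Nat.ListAction.Properties using (∈⇒∣product)
open import Data.Nat.Primality using (Prime; euclidsLemma; prime⇒nonTrivial)
open import Data.Nat.Primality.Factorisation using (factorise; PrimeFactorisation)
import Data.Nat.Solver as ℕS
open import Data.Integer.Base as ℤ using (ℤ; 0ℤ)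
import Data.Integer.Properties as ℤP
open import Data.Rational.Base hiding (∣_∣)
open import Data.Rational.Properties
open import Data.Rational.Solver using (module +-*-Solver)
open import Algebra.Bundles using (CommutativeRing)
open import Algebra.Definitions.RawSemiring +-*-rawSemiring using (_^_)
open import Algebra.Properties.Semiring.Exp (CommutativeRing.semiring +-*-commutativeRing)
  using (^-homo-*; ^-assocʳ)
open import Data.List.Base
  using (List; []; _∷_; _++_; foldr; map; concatMap; upTo; cartesianProduct)
open import Data.List.Properties using (map-upTo)
open import Data.List.Membership.Propositional using (_∈_; lose)
open import Data.List.Membership.Propositional.Properties
open import Data.List.Relation.Unary.All as All using (All; []; _∷_)
import Data.List.Relation.Unary.All.Properties as AllP
open import Data.List.Relation.Unary.AllPairs using ([]; _∷_)
open import Data.List.Relation.Unary.Any using (here; there)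
open import Data.List.Relation.Unary.Unique.Propositional using (Unique)
import Data.List.Relation.Unary.Unique.Propositional.Properties as UniqueP
open import Data.Product.Base using (∃; ∃₂; _×_; _,_; proj₁; proj₂)
open import Data.Sum.Base using (_⊎_; inj₁; inj₂; [_,_]′)
open import Data.Unit.Base using (⊤; tt)
open import Function.Base using (_∘_)
open import Relation.Nullary using (yes; no; contradiction)
open import Relation.Nullary.Decidable using (from-yes)
open import Relation.Binary.PropositionalEquality

open PrimeFactorisation
open +-*-Solver using (solve; con; _:+_; _:*_; _:-_; :-_; _:=_)
open ℕS.+-*-Solver using (_:^_) renaming
  (solve to solveℕ; con to conℕ; _:+_ to infixl 6 _⊕_; _:*_ to infixl 7 _⊗_; _:=_ to infix 4 _⊜_)

private variable
  A B Θ : Set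

-- Finite sums and their majorants

∑ : List A → (A → ℚ) → ℚ
∑ xs f = foldr _+_ 0ℚ (map f xs)

∑-mono : ∀ (xs : List A) {f g} → (∀ x → f x ≤ g x) → ∑ xs f ≤ ∑ xs g
∑-mono []       f≤g = ≤-refl
∑-mono (x ∷ xs) f≤g = +-mono-≤ (f≤g x) (∑-mono xs f≤g)

∑-++ : ∀ (xs : List A) {ys f} → ∑ (xs ++ ys) f ≡ ∑ xs f + ∑ ys f
∑-++ []                    = sym (+-identityˡ _)
∑-++ (x ∷ xs) {ys} {f} = trans (cong (f x +_) (∑-++ xs)) (sym (+-assoc (f x) (∑ xs f) (∑ ys f)))

∑-*ˡ : ∀ (xs : List A) {f} p → ∑ xs (λ x → p * f x) ≡ p * ∑ xs f
∑-*ˡ []           p = sym (*-zeroʳ p)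
∑-*ˡ (x ∷ xs) {f} p =
  trans (cong (p * f x +_) (∑-*ˡ xs p)) (sym (*-distribˡ-+ p (f x) (∑ xs f)))

∑-map : ∀ (xs : List A) {h : A → B} {f} → ∑ (map h xs) f ≡ ∑ xs (f ∘ h)
∑-map []               = refl
∑-map (x ∷ xs) {h} {f} = cong (f (h x) +_) (∑-map xs)

∑-cartesianProduct : ∀ (xs : List A) (ys : List B) {f} →
  ∑ (cartesianProduct xs ys) f ≡ ∑ xs (λ x → ∑ ys (λ y → f (x , y)))
∑-cartesianProduct []       ys     = refl
∑-cartesianProduct (x ∷ xs) ys {f} = trans (∑-++ (map (x ,_) ys))
  (cong₂ _+_ (∑-map ys) (∑-cartesianProduct xs ys))

0≤∑ : ∀ (xs : List A) {f} → (∀ x → 0ℚ ≤ f x) → 0ℚ ≤ ∑ xs f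
0≤∑ []       0≤f = ≤-refl
0≤∑ (x ∷ xs) 0≤f = 0≤+ (0≤f x) (0≤∑ xs 0≤f)

∑-⊆ : ∀ {xs ys : List A} {f} → (∀ x → 0ℚ ≤ f x) → Unique xs →
      (∀ {x} → x ∈ xs → x ∈ ys) → ∑ xs f ≤ ∑ ys f
∑-⊆ {ys = ys} 0≤f [] xs⊆ys = 0≤∑ ys 0≤f
∑-⊆ {xs = x ∷ xs} {f = f} 0≤f (x∉xs ∷ xs!) xs⊆ys with ∈-∃++ (xs⊆ys (here refl))
... | us , vs , refl = begin
  f x + ∑ xs f              ≤⟨ +-monoʳ-≤ (f x) (∑-⊆ 0≤f xs! rest) ⟩
  f x + ∑ (us ++ vs) f      ≡⟨ cong (f x +_) (∑-++ us) ⟩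
  f x + (∑ us f + ∑ vs f)   ≡⟨ solve 3 (λ a b c → a :+ (b :+ c) := b :+ (a :+ c)) refl (f x) (∑ us f) (∑ vs f) ⟩
  ∑ us f + (f x + ∑ vs f)   ≡⟨ ∑-++ us ⟨
  ∑ (us ++ x ∷ vs) f        ∎
  where
  open ≤-Reasoning
  rest : ∀ {y} → y ∈ xs → y ∈ us ++ vs
  rest y∈xs with ∈-++⁻ us (xs⊆ys (there y∈xs))
  ... | inj₁ y∈us         = ∈-++⁺ˡ y∈us
  ... | inj₂ (here refl)  = contradiction refl (All.lookup x∉xs y∈xs)
  ... | inj₂ (there y∈vs) = ∈-++⁺ʳ us y∈vs

∑-upTo-suc : ∀ n (f : ℕ → ℚ) → ∑ (upTo (suc n)) f ≡ f 0 + ∑ (upTo n) (f ∘ suc)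
∑-upTo-suc n f = trans (cong (foldr _+_ 0ℚ) (map-upTo f (suc n)))
  (cong (λ ps → f 0 + foldr _+_ 0ℚ ps) (sym (map-upTo (f ∘ suc) n)))

∑-upTo-const : ∀ n p → ∑ (upTo n) (λ _ → p) ≡ ι n * p
∑-upTo-const zero    p = sym (*-zeroˡ p)
∑-upTo-const (suc n) p = begin
  ∑ (upTo (suc n)) (λ _ → p)   ≡⟨ ∑-upTo-suc n (λ _ → p) ⟩
  p + ∑ (upTo n) (λ _ → p)     ≡⟨ cong (p +_) (∑-upTo-const n p) ⟩
  p + ι n * p                  ≡⟨ solve 2 (λ i p → p :+ i :* p := (con 1ℚ :+ i) :* p) refl (ι n) p ⟩
  (1ℚ + ι n) * p               ≡⟨ cong (_* p) (ι-suc n) ⟨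
  ι (suc n) * p                ∎
  where open ≡-Reasoning

-- The covering list may not depend on θ: in majorised-× the parameter of the inner sum is
-- the outer summation variable.
record Majorised {A Θ : Set} (P : A → Set) (f : Θ → A → ℚ) (C : ℚ) : Set where
  field
    0≤f   : ∀ θ x → 0ℚ ≤ f θ x
    0≤C   : 0ℚ ≤ C
    cover : ∀ xs → All P xs → ∃ λ ys → (∀ {x} → x ∈ xs → x ∈ ys) × (∀ θ → ∑ ys (f θ) ≤ C)

open Majorised

majorised-cong : ∀ {P Q : A → Set} {f g : Θ → A → ℚ} {C} → (∀ {x} → Q x → P x) →
  (∀ θ x → f θ x ≡ g θ x) → Majorised P f C → Majorised Q g C
majorised-cong Q⊆P f≡g F .0≤f θ x = subst (0ℚ ≤_) (f≡g θ x) (F .0≤f θ x)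
majorised-cong Q⊆P f≡g F .0≤C     = F .0≤C
majorised-cong Q⊆P f≡g F .cover xs qs with F .cover xs (All.map Q⊆P qs)
... | ys , ⊆ys , ys≤ =
  ys , ⊆ys , λ θ → ≤-trans (∑-mono ys (λ x → ≤-reflexive (sym (f≡g θ x)))) (ys≤ θ)

majorised-*ˡ : ∀ {P : A → Set} {f : Θ → A → ℚ} {C p} → 0ℚ ≤ p →
  Majorised P f C → Majorised P (λ θ x → p * f θ x) (p * C)
majorised-*ˡ 0≤p F .0≤f θ x = 0≤* 0≤p (F .0≤f θ x)
majorised-*ˡ 0≤p F .0≤C     = 0≤* 0≤p (F .0≤C)
majorised-*ˡ {p = p} 0≤p F .cover xs pxs with F .cover xs pxs
... | ys , ⊆ys , ys≤ =
  ys , ⊆ys , λ θ → ≤-trans (≤-reflexive (∑-*ˡ ys p)) (*-monoˡ 0≤p (ys≤ θ))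

majorised-⊤ : Majorised {⊤} {Θ} (λ _ → ⊤) (λ _ _ → 1ℚ) 1ℚ
majorised-⊤ .0≤f _ _    = 0≤1
majorised-⊤ .0≤C        = 0≤1
majorised-⊤ .cover xs _ = tt ∷ [] , (λ _ → here refl) , λ _ → ≤-refl

majorised-× : ∀ {P : A → Set} {Q : B → Set} {f : Θ → A → ℚ} {g : Θ × A → B → ℚ} {C D} →
  Majorised P f C → Majorised Q g D →
  Majorised {A × B} {Θ} (λ (x , y) → P x × Q y) (λ θ (x , y) → f θ x * g (θ , x) y) (C * D)
majorised-× F G .0≤f θ (x , y) = 0≤* (F .0≤f θ x) (G .0≤f (θ , x) y)
majorised-× F G .0≤C           = 0≤* (F .0≤C) (G .0≤C)
majorised-× {f = f} {g} {C} {D} F G .cover xys pqs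
  with F .cover (map proj₁ xys) (AllP.map⁺ (All.map proj₁ pqs))
     | G .cover (map proj₂ xys) (AllP.map⁺ (All.map proj₂ pqs))
... | xs , xs⊇ , xs≤ | ys , ys⊇ , ys≤ =
  cartesianProduct xs ys ,
  (λ xy∈ → ∈-cartesianProduct⁺ (xs⊇ (∈-map⁺ proj₁ xy∈)) (ys⊇ (∈-map⁺ proj₂ xy∈))) ,
  bound
  where
  open ≤-Reasoning
  bound : ∀ θ → ∑ (cartesianProduct xs ys) (λ (x , y) → f θ x * g (θ , x) y) ≤ C * D
  bound θ = begin
    ∑ (cartesianProduct xs ys) (λ (x , y) → f θ x * g (θ , x) y)
      ≡⟨ ∑-cartesianProduct xs ys ⟩
    ∑ xs (λ x → ∑ ys (λ y → f θ x * g (θ , x) y))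
      ≤⟨ ∑-mono xs (λ x → begin
           ∑ ys (λ y → f θ x * g (θ , x) y)  ≡⟨ ∑-*ˡ ys (f θ x) ⟩
           f θ x * ∑ ys (g (θ , x))          ≤⟨ *-monoˡ (F .0≤f θ x) (ys≤ (θ , x)) ⟩
           f θ x * D                         ≡⟨ *-comm (f θ x) D ⟩
           D * f θ x                         ∎) ⟩
    ∑ xs (λ x → D * f θ x)                   ≡⟨ ∑-*ˡ xs D ⟩
    D * ∑ xs (f θ)                           ≤⟨ *-monoˡ (G .0≤C) (xs≤ θ) ⟩
    D * C                                    ≡⟨ *-comm D C ⟩
    C * D                                    ∎

majorised-ℕ : ∀ {f : Θ → ℕ → ℚ} {C} → (∀ θ n → 0ℚ ≤ f θ n) → 0ℚ ≤ C →
  (∀ θ n → ∑ (upTo n) (f θ) ≤ C) → Majorised (λ _ → ⊤) f C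
majorised-ℕ 0≤f 0≤C f≤ .0≤f        = 0≤f
majorised-ℕ 0≤f 0≤C f≤ .0≤C        = 0≤C
majorised-ℕ 0≤f 0≤C f≤ .cover xs _ =
  upTo (suc (max xs)) , (λ x∈ → ∈-upTo⁺ (s≤s (≤max x∈))) , λ θ → f≤ θ (suc (max xs))
  where
  max : List ℕ → ℕ
  max = foldr ℕ._⊔_ 0
  ≤max : ∀ {x xs} → x ∈ xs → x ℕ.≤ max xs
  ≤max {x} {_ ∷ xs} (here refl) = ℕP.m≤m⊔n x (max xs)
  ≤max {x} {y ∷ xs} (there x∈)  = ℕP.≤-trans (≤max x∈) (ℕP.m≤n⊔m y (max xs))

∑≤majorant : ∀ {I : Set} {P : A → Set} {w : A → ℚ} {C} (decode : A → I) {f : I → ℚ} →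
  Majorised {Θ = ⊤} P (λ _ → w) C →
  ∀ {is} → Unique is → All (λ i → ∃ λ x → P x × decode x ≡ i × f i ≤ w x) is → ∑ is f ≤ C
∑≤majorant {A = A} {P = P} {w} {C} decode {f} W {is} is! coded with codes is coded
  where
  codes : ∀ is → All (λ i → ∃ λ x → P x × decode x ≡ i × f i ≤ w x) is →
    ∃ λ xs → All P xs × map decode xs ≡ is × ∑ is f ≤ ∑ xs w
  codes []       []                          = [] , [] , refl , ≤-refl
  codes (i ∷ is) ((x , px , eq , le) ∷ rest) with codes is rest
  ... | xs , pxs , eqs , les = x ∷ xs , px ∷ pxs , cong₂ _∷_ eq eqs , +-mono-≤ le les
... | xs , pxs , refl , les with W .cover xs pxs
... | ys , ⊆ys , ≤C = ≤-trans les (≤-trans (∑-⊆ (W .0≤f tt) (UniqueP.map⁻ is!) ⊆ys) (≤C tt))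

-- The code weights

0≤^ : ∀ {p} → 0ℚ ≤ p → ∀ n → 0ℚ ≤ p ^ n
0≤^ 0≤p zero    = 0≤1
0≤^ 0≤p (suc n) = 0≤* 0≤p (0≤^ 0≤p n)

^-mono : ∀ {p q} → 0ℚ ≤ p → p ≤ q → ∀ n → p ^ n ≤ q ^ n
^-mono 0≤p p≤q zero    = ≤-refl
^-mono 0≤p p≤q (suc n) = *-mono 0≤p p≤q (0≤^ 0≤p n) (^-mono 0≤p p≤q n)

0≤½^ : ∀ n → 0ℚ ≤ ½ ^ n
0≤½^ = 0≤^ (<⇒≤ 0<½)

ι[2^n]*½^n≡1 : ∀ n → ι (2 ℕ.^ n) * ½ ^ n ≡ 1ℚ
ι[2^n]*½^n≡1 zero    = refl
ι[2^n]*½^n≡1 (suc n) = begin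
  ι (2 ℕ.* 2 ℕ.^ n) * (½ * ½ ^ n)   ≡⟨ cong (_* (½ * ½ ^ n)) (ι-* 2 (2 ℕ.^ n)) ⟩
  ι 2 * ι (2 ℕ.^ n) * (½ * ½ ^ n)
    ≡⟨ solve 2 (λ i h → con (ι 2) :* i :* (con ½ :* h) := i :* h) refl (ι (2 ℕ.^ n)) (½ ^ n) ⟩
  ι (2 ℕ.^ n) * ½ ^ n               ≡⟨ ι[2^n]*½^n≡1 n ⟩
  1ℚ                                ∎
  where open ≡-Reasoning

-- σ = 7/8, chosen so that ½ ≤ σ⁵: a factor ½ pays for five factors σ.
open Geometric {η = ℤ.+ 1 / 8} (positive⁻¹ _) (from-yes (ℤ.+ 1 / 8 ≤? 1ℚ)) public
  using () renaming (ρ to σ; 0≤ρ to 0≤σ; 0≤ρ^ to 0≤σ^; ρ^-antimono to σ^-antimono)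

∑σ^≤8 : ∀ n → ∑ (upTo n) (σ ^_) ≤ ι 8
∑σ^≤8 zero    = 0≤ι 8
∑σ^≤8 (suc n) = begin
  ∑ (upTo (suc n)) (σ ^_)                 ≡⟨ ∑-upTo-suc n (σ ^_) ⟩
  1ℚ + ∑ (upTo n) (λ x → σ * σ ^ x)       ≡⟨ cong (1ℚ +_) (∑-*ˡ (upTo n) σ) ⟩
  1ℚ + σ * ∑ (upTo n) (σ ^_)              ≤⟨ +-monoʳ-≤ 1ℚ (*-monoˡ 0≤σ (∑σ^≤8 n)) ⟩
  1ℚ + σ * ι 8                            ≡⟨⟩
  ι 8                                     ∎
  where open ≤-Reasoning

∑σ^[x∸t]≤ : ∀ t n → ∑ (upTo n) (λ x → σ ^ (x ℕ.∸ t)) ≤ ι (8 ℕ.+ t)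
∑σ^[x∸t]≤ zero    n       = ∑σ^≤8 n
∑σ^[x∸t]≤ (suc t) zero    = 0≤ι (8 ℕ.+ suc t)
∑σ^[x∸t]≤ (suc t) (suc n) = begin
  ∑ (upTo (suc n)) (λ x → σ ^ (x ℕ.∸ suc t)) ≡⟨ ∑-upTo-suc n (λ x → σ ^ (x ℕ.∸ suc t)) ⟩
  1ℚ + ∑ (upTo n) (λ x → σ ^ (x ℕ.∸ t))      ≤⟨ +-monoʳ-≤ 1ℚ (∑σ^[x∸t]≤ t n) ⟩
  1ℚ + ι (8 ℕ.+ t)                           ≡⟨ ι-suc (8 ℕ.+ t) ⟨
  ι (8 ℕ.+ suc t)                            ∎
  where open ≤-Reasoning

∑σ^∣x-t∣≤ : ∀ t n → ∑ (upTo n) (λ x → σ ^ ℕ.∣ x - t ∣) + ι 8 * σ ^ suc t ≤ ι 16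
∑σ^∣x-t∣≤ zero    n       = begin
  ∑ (upTo n) (λ x → σ ^ ℕ.∣ x - 0 ∣) + ι 8 * σ ^ 1
    ≤⟨ +-monoˡ-≤ (ι 8 * σ ^ 1) (∑-mono (upTo n) (λ x → ≤-reflexive (cong (σ ^_) (ℕP.∣-∣-identityʳ x)))) ⟩
  ∑ (upTo n) (σ ^_) + ι 8 * σ ^ 1   ≤⟨ +-monoˡ-≤ (ι 8 * σ ^ 1) (∑σ^≤8 n) ⟩
  ι 8 + ι 8 * σ ^ 1                 ≤⟨ from-yes (ι 8 + ι 8 * σ ^ 1 ≤? ι 16) ⟩
  ι 16                              ∎
  where open ≤-Reasoning
∑σ^∣x-t∣≤ (suc t) zero    = begin
  0ℚ + ι 8 * σ ^ suc (suc t)   ≡⟨ +-identityˡ (ι 8 * σ ^ suc (suc t)) ⟩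
  ι 8 * σ ^ suc (suc t)        ≤⟨ *-monoˡ (0≤ι 8) (σ^-antimono {0} {suc (suc t)} z≤n) ⟩
  ι 8 * 1ℚ                     ≤⟨ from-yes (ι 8 * 1ℚ ≤? ι 16) ⟩
  ι 16                         ∎
  where open ≤-Reasoning
∑σ^∣x-t∣≤ (suc t) (suc n) = begin
  ∑ (upTo (suc n)) (λ x → σ ^ ℕ.∣ x - suc t ∣) + ι 8 * (σ * σ ^ suc t)
    ≡⟨ cong (_+ ι 8 * (σ * σ ^ suc t)) (∑-upTo-suc n (λ x → σ ^ ℕ.∣ x - suc t ∣)) ⟩
  σ ^ suc t + ∑ (upTo n) (λ x → σ ^ ℕ.∣ x - t ∣) + ι 8 * (σ * σ ^ suc t)
    ≡⟨ solve 2 (λ s p → p :+ s :+ con (ι 8) :* (con σ :* p) := s :+ con (ι 8) :* p)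
         refl (∑ (upTo n) (λ x → σ ^ ℕ.∣ x - t ∣)) (σ ^ suc t) ⟩
  ∑ (upTo n) (λ x → σ ^ ℕ.∣ x - t ∣) + ι 8 * σ ^ suc t
    ≤⟨ ∑σ^∣x-t∣≤ t n ⟩
  ι 16 ∎
  where open ≤-Reasoning

∑σ^∣x+u-t∣≤16 : ∀ u t n → ∑ (upTo n) (λ x → σ ^ ℕ.∣ x ℕ.+ u - t ∣) ≤ ι 16
∑σ^∣x+u-t∣≤16 zero t n = ≤-trans
  (∑-mono (upTo n) (λ x → ≤-reflexive (cong (λ y → σ ^ ℕ.∣ y - t ∣) (ℕP.+-identityʳ x))))
  (≤-trans (≤-by (ι 8 * σ ^ suc t) refl (0≤* (0≤ι 8) (0≤σ^ (suc t)))) (∑σ^∣x-t∣≤ t n))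
∑σ^∣x+u-t∣≤16 (suc u) zero n = ≤-trans
  (∑-mono (upTo n) (λ x → σ^-antimono (ℕP.≤-trans (ℕP.m≤m+n x (suc u))
    (ℕP.≤-reflexive (sym (ℕP.∣-∣-identityʳ (x ℕ.+ suc u)))))))
  (≤-trans (∑σ^≤8 n) (from-yes (ι 8 ≤? ι 16)))
∑σ^∣x+u-t∣≤16 (suc u) (suc t) n = ≤-trans
  (∑-mono (upTo n) (λ x → ≤-reflexive (cong (λ y → σ ^ ℕ.∣ y - suc t ∣) (ℕP.+-suc x u))))
  (∑σ^∣x+u-t∣≤16 u t n)

∑-concatMap : ∀ (xs : List A) {h : A → List B} {f} →
  ∑ (concatMap h xs) f ≡ ∑ xs (λ x → ∑ (h x) f)
∑-concatMap []               = refl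
∑-concatMap (x ∷ xs) {h} {f} = trans (∑-++ (h x)) (cong (∑ (h x) f +_) (∑-concatMap xs))

-- (e , i) with i < 2ᵉ stands for the positive integer 2ᵉ + i.
Dyadic : Set
Dyadic = ℕ × ℕ

IsDyadic : Dyadic → Set
IsDyadic (e , i) = i ℕ.< 2 ℕ.^ e

majorised-dyadic : ∀ {f : Θ → ℕ → ℚ} {C} → Majorised (λ _ → ⊤) f C →
  Majorised IsDyadic (λ θ (e , i) → ½ ^ e * f θ e) C
majorised-dyadic F .0≤f θ (e , _) = 0≤* (0≤½^ e) (F .0≤f θ e)
majorised-dyadic F .0≤C           = F .0≤C
majorised-dyadic {f = f} {C} F .cover eis <s
  with F .cover (map proj₁ eis) (All.universal (λ _ → tt) _)
... | es , ⊆es , es≤ = concatMap block es , ⊆box , bound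
  where
  block : ℕ → List Dyadic
  block e = map (e ,_) (upTo (2 ℕ.^ e))
  ⊆box : ∀ {x} → x ∈ eis → x ∈ concatMap block es
  ⊆box {e , i} x∈ = ∈-concatMap⁺ block
    (lose (⊆es (∈-map⁺ proj₁ x∈)) (∈-map⁺ (e ,_) (∈-upTo⁺ (All.lookup <s x∈))))
  open ≤-Reasoning
  bound : ∀ θ → ∑ (concatMap block es) (λ (e , i) → ½ ^ e * f θ e) ≤ C
  bound θ = begin
    ∑ (concatMap block es) (λ (e , i) → ½ ^ e * f θ e)
      ≡⟨ ∑-concatMap es ⟩
    ∑ es (λ e → ∑ (block e) (λ (e , i) → ½ ^ e * f θ e))
      ≤⟨ ∑-mono es (λ e → ≤-reflexive (begin-equality
           ∑ (block e) (λ (e , i) → ½ ^ e * f θ e)     ≡⟨ ∑-map (upTo (2 ℕ.^ e)) ⟩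
           ∑ (upTo (2 ℕ.^ e)) (λ _ → ½ ^ e * f θ e)    ≡⟨ ∑-upTo-const (2 ℕ.^ e) _ ⟩
           ι (2 ℕ.^ e) * (½ ^ e * f θ e)               ≡⟨ *-assoc (ι (2 ℕ.^ e)) (½ ^ e) (f θ e) ⟨
           ι (2 ℕ.^ e) * ½ ^ e * f θ e                 ≡⟨ cong (_* f θ e) (ι[2^n]*½^n≡1 e) ⟩
           1ℚ * f θ e                                  ≡⟨ *-identityˡ (f θ e) ⟩
           f θ e                                       ∎)) ⟩
    ∑ es (f θ) ≤⟨ es≤ θ ⟩
    C ∎

Exponents : ℕ → Set
Exponents zero    = ⊤
Exponents (suc n) = ℕ × Exponents n

value : ∀ {n} → Exponents n → ℕ
value {zero}  _       = 1
value {suc n} (k , v) = (2 ℕ.+ n) ℕ.^ k ℕ.* value v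

total : ∀ {n} → Exponents n → ℕ
total {zero}  _       = 0
total {suc n} (k , v) = k ℕ.+ total v

majorised-exponents : ∀ n → Majorised {Θ = Θ} (λ _ → ⊤) (λ _ v → σ ^ total {n} v) (ι 8 ^ n)
majorised-exponents zero    = majorised-⊤
majorised-exponents (suc n) = majorised-cong (λ _ → tt , tt)
  (λ _ (k , v) → sym (^-homo-* σ k (total v)))
  (majorised-× (majorised-ℕ (λ _ → 0≤σ^) (0≤ι 8) (λ _ → ∑σ^≤8)) (majorised-exponents n))

Code : ℕ → Set
Code N = ((Dyadic × Dyadic) × Dyadic) × ((Exponents N × Exponents N) × Exponents N)

IsCode : ∀ {N} → Code N → Set
IsCode (((g , a) , b) , _) = (IsDyadic g × IsDyadic a) × IsDyadic b

weight : ∀ {N} → ℕ → Code N → ℚ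
weight t ((((e₁ , _) , (e₂ , _)) , (e₃ , _)) , ((u , v) , w)) =
  ½ ^ (e₁ ℕ.+ e₂ ℕ.+ e₃) *
  σ ^ ((e₁ ℕ.∸ t ℕ.+ (e₂ ℕ.∸ t) ℕ.+ ℕ.∣ e₃ ℕ.+ (e₁ ℕ.+ e₂ ℕ.+ 4) - t ∣) ℕ.+
       (total u ℕ.+ total v ℕ.+ total w))

majorised-weight : ∀ t N → Majorised {Θ = ⊤} (IsCode {N}) (λ _ → weight t)
  (ι (8 ℕ.+ t) * ι (8 ℕ.+ t) * ι 16 * (ι 8 ^ N * ι 8 ^ N * ι 8 ^ N))
majorised-weight t N = majorised-cong (λ p → p , ((tt , tt) , tt)) (λ _ → factor)
  (majorised-×
    (majorised-× (majorised-× outer outer)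
      (majorised-dyadic {f = λ (_ , (e₁ , _) , (e₂ , _)) x → σ ^ ℕ.∣ x ℕ.+ (e₁ ℕ.+ e₂ ℕ.+ 4) - t ∣}
        (majorised-ℕ (λ (_ , (e₁ , _) , (e₂ , _)) x → 0≤σ^ ℕ.∣ x ℕ.+ (e₁ ℕ.+ e₂ ℕ.+ 4) - t ∣) (0≤ι 16)
          (λ (_ , (e₁ , _) , (e₂ , _)) → ∑σ^∣x+u-t∣≤16 (e₁ ℕ.+ e₂ ℕ.+ 4) t))))
    (majorised-× (majorised-× (majorised-exponents N) (majorised-exponents N))
      (majorised-exponents N)))
  where
  outer : ∀ {Θ : Set} → Majorised {Θ = Θ} IsDyadic (λ _ (e , _) → ½ ^ e * σ ^ (e ℕ.∸ t)) (ι (8 ℕ.+ t))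
  outer = majorised-dyadic (majorised-ℕ (λ _ e → 0≤σ^ (e ℕ.∸ t)) (0≤ι (8 ℕ.+ t)) (λ _ → ∑σ^[x∸t]≤ t))
  ^-homo₃ : ∀ p a b c → p ^ (a ℕ.+ b ℕ.+ c) ≡ p ^ a * p ^ b * p ^ c
  ^-homo₃ p a b c = trans (^-homo-* p (a ℕ.+ b) c) (cong (_* p ^ c) (^-homo-* p a b))
  factor : ∀ (c : Code N) → let ((((e₁ , _) , (e₂ , _)) , (e₃ , _)) , ((u , v) , w)) = c in
    ½ ^ e₁ * σ ^ (e₁ ℕ.∸ t) * (½ ^ e₂ * σ ^ (e₂ ℕ.∸ t)) *
    (½ ^ e₃ * σ ^ ℕ.∣ e₃ ℕ.+ (e₁ ℕ.+ e₂ ℕ.+ 4) - t ∣) *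
    (σ ^ total u * σ ^ total v * σ ^ total w) ≡ weight t c
  factor ((((e₁ , _) , (e₂ , _)) , (e₃ , _)) , ((u , v) , w)) = sym (begin
    ½ ^ (e₁ ℕ.+ e₂ ℕ.+ e₃) * σ ^ (a ℕ.+ b ℕ.+ c ℕ.+ (total u ℕ.+ total v ℕ.+ total w))
      ≡⟨ cong₂ _*_ (^-homo₃ ½ e₁ e₂ e₃) (trans (^-homo-* σ (a ℕ.+ b ℕ.+ c) _)
           (cong₂ _*_ (^-homo₃ σ a b c) (^-homo₃ σ (total u) (total v) (total w)))) ⟩
    ½ ^ e₁ * ½ ^ e₂ * ½ ^ e₃ * (σ ^ a * σ ^ b * σ ^ c * z)
      ≡⟨ solve 7 (λ h i j p q r z → h :* i :* j :* (p :* q :* r :* z)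
                 := h :* p :* (i :* q) :* (j :* r) :* z) refl
           (½ ^ e₁) (½ ^ e₂) (½ ^ e₃) (σ ^ a) (σ ^ b) (σ ^ c) z ⟩
    ½ ^ e₁ * σ ^ a * (½ ^ e₂ * σ ^ b) * (½ ^ e₃ * σ ^ c) * z ∎)
    where
    open ≡-Reasoning
    a = e₁ ℕ.∸ t
    b = e₂ ℕ.∸ t
    c = ℕ.∣ e₃ ℕ.+ (e₁ ℕ.+ e₂ ℕ.+ 4) - t ∣
    z = σ ^ total u * σ ^ total v * σ ^ total w

∸-superadditive : ∀ a b t → a ℕ.∸ t ℕ.+ (b ℕ.∸ t) ℕ.≤ (a ℕ.+ b) ℕ.∸ t
∸-superadditive a b t with ℕP.≤-total t a
... | inj₁ t≤a = ℕP.≤-trans (ℕP.+-monoʳ-≤ (a ℕ.∸ t) (ℕP.m∸n≤m b t))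
  (ℕP.≤-reflexive (sym (ℕP.+-∸-comm b t≤a)))
... | inj₂ a≤t rewrite ℕP.m≤n⇒m∸n≡0 a≤t = ℕP.∸-monoˡ-≤ t (ℕP.m≤n+m b a)

recip-unique : ∀ {p q} → 0ℚ < p → p * q ≡ 1ℚ → recip p ≡ q
recip-unique {p} {q} 0<p pq≡1 = begin
  recip p             ≡⟨ *-identityʳ (recip p) ⟨
  recip p * 1ℚ        ≡⟨ cong (recip p *_) pq≡1 ⟨
  recip p * (p * q)   ≡⟨ solve 3 (λ r p q → r :* (p :* q) := p :* (q :* r)) refl (recip p) p q ⟩
  p * (q * recip p)   ≡⟨ *-recip-cancel 0<p q ⟩
  q                   ∎
  where open ≡-Reasoning

0<ι[2^n] : ∀ n → 0ℚ < ι (2 ℕ.^ n)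
0<ι[2^n] n = <-≤-trans 0<1 (ι-mono (ℕP.m^n>0 2 n))

recip-ι[2^n] : ∀ n → recip (ι (2 ℕ.^ n)) ≡ ½ ^ n
recip-ι[2^n] n = recip-unique (0<ι[2^n] n) (ι[2^n]*½^n≡1 n)

½^≤2σ^ : ∀ {k n} → k ℕ.≤ suc (5 ℕ.* n) → ½ ^ n ≤ ι 2 * σ ^ k
½^≤2σ^ {k} {n} k≤ = begin
  ½ ^ n                       ≤⟨ ^-mono (<⇒≤ 0<½) (from-yes (½ ≤? σ ^ 5)) n ⟩
  (σ ^ 5) ^ n                 ≡⟨ ^-assocʳ σ 5 n ⟩
  σ ^ (5 ℕ.* n)               ≡⟨ *-identityˡ _ ⟨
  1ℚ * σ ^ (5 ℕ.* n)          ≤⟨ *-mono 0≤1 (from-yes (1ℚ ≤? ι 2 * σ)) (0≤σ^ (5 ℕ.* n)) ≤-refl ⟩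
  ι 2 * σ * σ ^ (5 ℕ.* n)     ≡⟨ *-assoc (ι 2) σ (σ ^ (5 ℕ.* n)) ⟩
  ι 2 * σ ^ suc (5 ℕ.* n)     ≤⟨ *-monoˡ (0≤ι 2) (σ^-antimono k≤) ⟩
  ι 2 * σ ^ k                 ∎
  where open ≤-Reasoning

exponent≤ : ∀ e₁ e₂ e₃ {t s E Ω} → e₁ ℕ.+ e₂ ℕ.+ e₃ ℕ.+ E ℕ.+ 4 ≡ t ℕ.+ s → Ω ℕ.≤ suc (E ℕ.+ E) →
  (e₁ ℕ.∸ t ℕ.+ (e₂ ℕ.∸ t) ℕ.+ ℕ.∣ e₃ ℕ.+ (e₁ ℕ.+ e₂ ℕ.+ 4) - t ∣) ℕ.+ Ω ℕ.≤ suc (5 ℕ.* (s ℕ.+ E))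
exponent≤ e₁ e₂ e₃ {t} {s} {E} {Ω} t+s Ω≤ = κ≤
  where
  open ℕP.≤-Reasoning
  x κ : ℕ
  x = e₃ ℕ.+ (e₁ ℕ.+ e₂ ℕ.+ 4)
  κ = (e₁ ℕ.∸ t ℕ.+ (e₂ ℕ.∸ t) ℕ.+ ℕ.∣ x - t ∣) ℕ.+ Ω
  E+x≡ : E ℕ.+ x ≡ t ℕ.+ s
  E+x≡ = trans (solveℕ 4 (λ E a b c → E ⊕ (c ⊕ (a ⊕ b ⊕ conℕ 4)) ⊜ a ⊕ b ⊕ c ⊕ E ⊕ conℕ 4) refl E e₁ e₂ e₃) t+s
  ∣x-t∣≤ : ℕ.∣ x - t ∣ ℕ.≤ s ℕ.+ E
  ∣x-t∣≤ = begin
    ℕ.∣ x - t ∣                  ≡⟨ ℕP.∣m+n-m+o∣≡∣n-o∣ E x t ⟨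
    ℕ.∣ E ℕ.+ x - E ℕ.+ t ∣      ≡⟨ cong₂ ℕ.∣_-_∣ E+x≡ (ℕP.+-comm E t) ⟩
    ℕ.∣ t ℕ.+ s - t ℕ.+ E ∣      ≡⟨ ℕP.∣m+n-m+o∣≡∣n-o∣ t s E ⟩
    ℕ.∣ s - E ∣                  ≤⟨ ℕP.∣m-n∣≤m⊔n s E ⟩
    s ℕ.⊔ E                      ≤⟨ ℕP.m⊔n≤m+n s E ⟩
    s ℕ.+ E                      ∎
  e₁₂≤ : e₁ ℕ.∸ t ℕ.+ (e₂ ℕ.∸ t) ℕ.≤ s ℕ.+ E
  e₁₂≤ = begin
    e₁ ℕ.∸ t ℕ.+ (e₂ ℕ.∸ t)      ≤⟨ ∸-superadditive e₁ e₂ t ⟩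
    e₁ ℕ.+ e₂ ℕ.∸ t              ≤⟨ ℕP.∸-monoˡ-≤ t (ℕP.≤-trans (ℕP.m≤m+n (e₁ ℕ.+ e₂) 4) (ℕP.m≤n+m _ e₃)) ⟩
    x ℕ.∸ t                      ≤⟨ ℕP.m∸n≤∣m-n∣ x t ⟩
    ℕ.∣ x - t ∣                  ≤⟨ ∣x-t∣≤ ⟩
    s ℕ.+ E                      ∎
  κ≤ : κ ℕ.≤ suc (5 ℕ.* (s ℕ.+ E))
  κ≤ = begin
    κ                            ≤⟨ ℕP.+-mono-≤ (ℕP.+-mono-≤ e₁₂≤ ∣x-t∣≤) Ω≤ ⟩
    (s ℕ.+ E) ℕ.+ (s ℕ.+ E) ℕ.+ suc (E ℕ.+ E)
      ≤⟨ ℕP.m≤m+n _ (s ℕ.+ s ℕ.+ s ℕ.+ E) ⟩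
    (s ℕ.+ E) ℕ.+ (s ℕ.+ E) ℕ.+ suc (E ℕ.+ E) ℕ.+ (s ℕ.+ s ℕ.+ s ℕ.+ E)
      ≡⟨ solveℕ 2 (λ s E → s ⊕ E ⊕ (s ⊕ E) ⊕ (conℕ 1 ⊕ (E ⊕ E)) ⊕ (s ⊕ s ⊕ s ⊕ E) ⊜ conℕ 1 ⊕ conℕ 5 ⊗ (s ⊕ E)) refl s E ⟩
    suc (5 ℕ.* (s ℕ.+ E))        ∎

-- With t + s = e + E + 4, the factor 4^-(e + E) is 16 · 2^-t · 2^-e · 2^-(s + E), and s + E
-- controls both ∣ e + 4 - t ∣ ≤ s + E and total u + total v + total w ≤ 2E + 1.
recip≤weight : ∀ {N} (c : Code N) {m t E s} →
  let ((((e₁ , _) , (e₂ , _)) , (e₃ , _)) , ((u , v) , w)) = c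
      e = e₁ ℕ.+ e₂ ℕ.+ e₃ in
  2 ℕ.^ (e ℕ.+ (e ℕ.+ E ℕ.+ E)) ℕ.≤ m →
  e ℕ.+ E ℕ.+ 4 ≡ t ℕ.+ s →
  total u ℕ.+ total v ℕ.+ total w ℕ.≤ suc (E ℕ.+ E) →
  recip (ι m) ≤ ι 32 * ½ ^ t * weight t c
recip≤weight c@((((e₁ , _) , (e₂ , _)) , (e₃ , _)) , ((u , v) , w)) {m} {t} {E} {s} 2^≤m t+s Ω≤ = begin
  recip (ι m)                              ≤⟨ recip-antimono (0<ι[2^n] k) (ι-mono 2^≤m) ⟩
  recip (ι (2 ℕ.^ k))                         ≡⟨ recip-ι[2^n] k ⟩
  ½ ^ (e ℕ.+ (e ℕ.+ E ℕ.+ E))              ≡⟨ trans (^-homo-* ½ e _) (cong (½ ^ e *_) (^-homo-* ½ (e ℕ.+ E) E)) ⟩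
  ½ ^ e * (½ ^ (e ℕ.+ E) * ½ ^ E)
    ≡⟨ solve 3 (λ a b c → a :* (b :* c) := con (ι 16) :* (b :* con (½ ^ 4)) :* a :* c) refl
         (½ ^ e) (½ ^ (e ℕ.+ E)) (½ ^ E) ⟩
  ι 16 * (½ ^ (e ℕ.+ E) * ½ ^ 4) * ½ ^ e * ½ ^ E
    ≡⟨ cong (λ p → ι 16 * p * ½ ^ e * ½ ^ E)
         (trans (sym (^-homo-* ½ (e ℕ.+ E) 4)) (trans (cong (½ ^_) t+s) (^-homo-* ½ t s))) ⟩
  ι 16 * (½ ^ t * ½ ^ s) * ½ ^ e * ½ ^ E
    ≡⟨ solve 5 (λ k a b c d → k :* (a :* b) :* c :* d := k :* a :* (c :* (b :* d))) refl
         (ι 16) (½ ^ t) (½ ^ s) (½ ^ e) (½ ^ E) ⟩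
  ι 16 * ½ ^ t * (½ ^ e * (½ ^ s * ½ ^ E))
    ≡⟨ cong (λ p → ι 16 * ½ ^ t * (½ ^ e * p)) (^-homo-* ½ s E) ⟨
  ι 16 * ½ ^ t * (½ ^ e * ½ ^ (s ℕ.+ E))
    ≤⟨ *-monoˡ (0≤* (0≤ι 16) (0≤½^ t)) (*-monoˡ (0≤½^ e) (½^≤2σ^ {κ} {s ℕ.+ E} (exponent≤ e₁ e₂ e₃ {t} {s} {E} t+s Ω≤))) ⟩
  ι 16 * ½ ^ t * (½ ^ e * (ι 2 * σ ^ κ))
    ≡⟨ solve 3 (λ a b c → con (ι 16) :* a :* (b :* (con (ι 2) :* c)) := con (ι 32) :* a :* (b :* c)) refl
         (½ ^ t) (½ ^ e) (σ ^ κ) ⟩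
  ι 32 * ½ ^ t * weight t c                ∎
  where
  open ≤-Reasoning
  e k κ : ℕ
  e = e₁ ℕ.+ e₂ ℕ.+ e₃
  k = e ℕ.+ (e ℕ.+ E ℕ.+ E)
  κ = (e₁ ℕ.∸ t ℕ.+ (e₂ ℕ.∸ t) ℕ.+ ℕ.∣ e₃ ℕ.+ (e₁ ℕ.+ e₂ ℕ.+ 4) - t ∣) ℕ.+
      (total u ℕ.+ total v ℕ.+ total w)

-- Encoding the range of summation

^-bracket : ∀ b → 2 ℕ.≤ b → ∀ n → 1 ℕ.≤ n → ∃ λ e → b ℕ.^ e ℕ.≤ n × n ℕ.< b ℕ.^ suc e
^-bracket b 2≤b (suc zero)    _ = 0 , ℕP.≤-refl , ℕP.≤-trans 2≤b (ℕP.≤-reflexive (sym (ℕP.*-identityʳ b)))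
^-bracket b 2≤b (suc (suc n)) _ with ^-bracket b 2≤b (suc n) (s≤s z≤n)
... | e , ≤n , n< with suc (suc n) ℕP.<? b ℕ.^ suc e
...   | yes 1+n< = e , ℕP.m≤n⇒m≤1+n ≤n , 1+n<
...   | no  1+n≮ = suc e , ℕP.≮⇒≥ 1+n≮ , ℕP.≤-<-trans n< (ℕP.^-monoʳ-< b 2≤b (ℕP.n<1+n (suc e)))

dyadicValue : Dyadic → ℕ
dyadicValue (e , i) = 2 ℕ.^ e ℕ.+ i

toDyadic : ∀ n → 1 ℕ.≤ n → ∃ λ x → IsDyadic x × dyadicValue x ≡ n
toDyadic n 1≤n with ^-bracket 2 ℕP.≤-refl n 1≤n
... | e , 2^e≤n , n<2^1+e = (e , n ℕ.∸ 2 ℕ.^ e) ,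
  ℕP.+-cancelˡ-< (2 ℕ.^ e) _ _ (ℕP.≤-trans
    (ℕP.≤-reflexive (cong suc (ℕP.m+[n∸m]≡n 2^e≤n)))
    (ℕP.≤-trans n<2^1+e (ℕP.≤-reflexive (cong (2 ℕ.^ e ℕ.+_) (ℕP.+-identityʳ (2 ℕ.^ e)))))) ,
  ℕP.m+[n∸m]≡n 2^e≤n

2^≤dyadicValue : ∀ x → 2 ℕ.^ proj₁ x ℕ.≤ dyadicValue x
2^≤dyadicValue (e , i) = ℕP.m≤m+n (2 ℕ.^ e) i

dyadicValue<2^ : ∀ x → IsDyadic x → dyadicValue x ℕ.< 2 ℕ.^ suc (proj₁ x)
dyadicValue<2^ (e , i) i< = ℕP.<-≤-trans (ℕP.+-monoʳ-< (2 ℕ.^ e) i<)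
  (ℕP.≤-reflexive (cong (2 ℕ.^ e ℕ.+_) (sym (ℕP.+-identityʳ (2 ℕ.^ e)))))

value-* : ∀ {n} q (v : Exponents n) → 2 ℕ.≤ q → q ℕ.≤ suc n → ∃ λ w → value {n} w ≡ q ℕ.* value v
value-* {zero}  q v       2≤q q≤ = contradiction (ℕP.≤-trans 2≤q q≤) λ { (s≤s ()) }
value-* {suc n} q (k , v) 2≤q q≤ with q ℕP.≟ 2 ℕ.+ n
... | yes refl = (suc k , v) , ℕP.*-assoc q (q ℕ.^ k) (value v)
... | no  q≢ with value-* {n} q v 2≤q (ℕP.≤-pred (ℕP.≤∧≢⇒< q≤ q≢))
...   | w , eq = (k , w) , trans (cong ((2 ℕ.+ n) ℕ.^ k ℕ.*_) eq)
  (solveℕ 3 (λ a q v → a ⊗ (q ⊗ v) ⊜ q ⊗ (a ⊗ v)) refl ((2 ℕ.+ n) ℕ.^ k) q (value v))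

value-product : ∀ {n} ps → All (λ p → 2 ℕ.≤ p × p ℕ.≤ suc n) ps → ∃ λ v → value {n} v ≡ product ps
value-product {n} []       []                 = ones n
  where
  ones : ∀ n → ∃ λ v → value {n} v ≡ 1
  ones zero    = tt , refl
  ones (suc n) = let v , eq = ones n in (0 , v) , trans (ℕP.+-identityʳ (value v)) eq
value-product {n} (p ∷ ps) ((2≤p , p≤) ∷ bds) with value-product {n} ps bds
... | v , eq with value-* p v 2≤p p≤
...   | w , eq′ = w , trans eq′ (cong (p ℕ.*_) eq)

toExponents : ∀ {Δ} → Δ ≢ 0ℤ → ∀ {d} → 1 ℕ.≤ d → PrimeFactorsDivide Δ d →
  ∃ λ v → value {ℤ.∣ Δ ∣} v ≡ d
toExponents {Δ} Δ≢0 {d} 1≤d smooth =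
  let v , eq = value-product (factors fac) (All.tabulate bounds)
  in v , trans eq (sym (isFactorisation fac))
  where
  instance
    d≢0 : ℕ.NonZero d
    d≢0 = ℕ.>-nonZero 1≤d
    ∣Δ∣≢0 : ℕ.NonZero ℤ.∣ Δ ∣
    ∣Δ∣≢0 = ℕ.≢-nonZero (Δ≢0 ∘ ℤP.∣i∣≡0⇒i≡0)
  fac : PrimeFactorisation d
  fac = factorise d
  bounds : ∀ {p} → p ∈ factors fac → 2 ℕ.≤ p × p ℕ.≤ suc ℤ.∣ Δ ∣
  bounds {p} p∈ = ℕ.nonTrivial⇒n>1 p {{prime⇒nonTrivial pr}} ,
    ℕP.m≤n⇒m≤1+n (ℕ∣.∣⇒≤ (smooth p pr
      (subst (p ∣_) (sym (isFactorisation fac)) (∈⇒∣product p∈))))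
    where
    pr : Prime p
    pr = All.lookup (factorsPrime fac) p∈

2^total≤value : ∀ {n} (v : Exponents n) → 2 ℕ.^ total v ℕ.≤ value v
2^total≤value {zero}  _       = ℕP.≤-refl
2^total≤value {suc n} (k , v) = ℕP.≤-trans (ℕP.≤-reflexive (ℕP.^-distribˡ-+-* 2 k (total v)))
  (ℕP.*-mono-≤ (ℕP.^-monoˡ-≤ k (s≤s (s≤s z≤n))) (2^total≤value v))

1≤value : ∀ {n} (v : Exponents n) → 1 ℕ.≤ value v
1≤value v = ℕP.≤-trans (ℕP.m^n>0 2 (total v)) (2^total≤value v)

gcd-split : ∀ m n → 1 ℕ.≤ m → ∃ λ g → ∃₂ λ a b →
  m ≡ g ℕ.* a × n ≡ g ℕ.* b × Coprime a b
gcd-split m n 1≤m = g , m ℕ./ g , n ℕ./ g ,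
  trans (sym (m/n*n≡m (GCD.gcd[m,n]∣m m n))) (ℕP.*-comm (m ℕ./ g) g) ,
  trans (sym (m/n*n≡m (GCD.gcd[m,n]∣n m n))) (ℕP.*-comm (n ℕ./ g) g) ,
  coprime-/gcd m n
  where
  g : ℕ
  g = GCD.gcd m n
  instance
    g≢0 : ℕ.NonZero g
    g≢0 = ℕ.≢-nonZero (GCD.gcd[m,n]≢0 m n (inj₁ (ℕP.>⇒≢ 1≤m)))

coprime-∣ˡ : ∀ {m n k} → k ∣ m → Coprime m n → Coprime k n
coprime-∣ˡ k∣m c (d∣k , d∣n) = c (ℕ∣.∣-trans d∣k k∣m , d∣n)

coprime-*ˡ : ∀ {m n k} → Coprime m k → Coprime n k → Coprime (m ℕ.* n) k
coprime-*ˡ cm cn (d∣mn , d∣k) =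
  cn (coprime-divisor (coprime-∣ˡ d∣k (Coprimality.sym cm)) d∣mn , d∣k)

coprime-^2 : ∀ {m n} → Coprime m n → Coprime (m ℕ.^ 2) n
coprime-^2 {m} {n} c = subst (λ k → Coprime (m ℕ.* k) n) (sym (ℕP.*-identityʳ m)) (coprime-*ˡ c c)

coprime-*-∣ : ∀ {k a b m} .{{_ : ℕ.NonZero k}} → Coprime a b →
  k ℕ.* a ∣ m → k ℕ.* b ∣ m → k ℕ.* a ℕ.* b ∣ m
coprime-*-∣ {k} {a} {b} {m} c (divides q m≡) kb∣m =
  subst (k ℕ.* a ℕ.* b ∣_) (sym (trans m≡ (ℕP.*-comm q (k ℕ.* a))))
    (ℕ∣.*-monoʳ-∣ (k ℕ.* a) (coprime-divisor (Coprimality.sym c) b∣aq))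
  where
  b∣aq : b ∣ a ℕ.* q
  b∣aq = ℕ∣.*-cancelˡ-∣ k (subst (k ℕ.* b ∣_)
    (trans m≡ (solveℕ 3 (λ q k a → q ⊗ (k ⊗ a) ⊜ k ⊗ (a ⊗ q)) refl q k a)) kb∣m)

modulus-split : ∀ g a b h x y →
  1 ℕ.≤ g → 1 ℕ.≤ h → Coprime a b → Coprime x y → Coprime (g ℕ.* a ℕ.* b) (h ℕ.* x ℕ.* y) →
  modulus (g ℕ.* a , g ℕ.* b , h ℕ.* x , h ℕ.* y) ≡ (g ℕ.* a ℕ.* b) ℕ.^ 2 ℕ.* (h ℕ.* x ℕ.* y)
modulus-split g a b h x y 1≤g 1≤h ab xy nD = ℕ∣.∣-antisym
  (lcm-least
    (divides (b ℕ.^ 2 ℕ.* y) (solveℕ 6 (λ g a b h x y →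
      (g ⊗ a ⊗ b) :^ 2 ⊗ (h ⊗ x ⊗ y) ⊜ b :^ 2 ⊗ y ⊗ ((g ⊗ a) :^ 2 ⊗ (h ⊗ x))) refl g a b h x y))
    (divides (a ℕ.^ 2 ℕ.* x) (solveℕ 6 (λ g a b h x y →
      (g ⊗ a ⊗ b) :^ 2 ⊗ (h ⊗ x ⊗ y) ⊜ a :^ 2 ⊗ x ⊗ ((g ⊗ b) :^ 2 ⊗ (h ⊗ y))) refl g a b h x y)))
  (subst (_∣ m) (cong (ℕ._* (h ℕ.* x ℕ.* y)) (ℕP.*-identityˡ ((g ℕ.* a ℕ.* b) ℕ.^ 2)))
    (coprime-*-∣ {1} (coprime-^2 nD) (subst (_∣ m) (sym (ℕP.*-identityˡ _)) n²∣m)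
                                 (subst (_∣ m) (sym (ℕP.*-identityˡ _)) D∣m)))
  where
  m : ℕ
  m = modulus (g ℕ.* a , g ℕ.* b , h ℕ.* x , h ℕ.* y)
  instance
    g≢0 : ℕ.NonZero g
    g≢0 = ℕ.>-nonZero 1≤g
    h≢0 : ℕ.NonZero h
    h≢0 = ℕ.>-nonZero 1≤h
    g²≢0 : ℕ.NonZero (g ℕ.^ 2)
    g²≢0 = ℕP.m^n≢0 g 2
  square-* : ∀ p q → (p ℕ.* q) ℕ.^ 2 ≡ p ℕ.^ 2 ℕ.* q ℕ.^ 2
  square-* = solveℕ 2 (λ p q → (p ⊗ q) :^ 2 ⊜ p :^ 2 ⊗ q :^ 2) refl
  ∣ˡ : (g ℕ.* a) ℕ.^ 2 ℕ.* (h ℕ.* x) ∣ m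
  ∣ˡ = m∣lcm[m,n] _ _
  ∣ʳ : (g ℕ.* b) ℕ.^ 2 ℕ.* (h ℕ.* y) ∣ m
  ∣ʳ = n∣lcm[m,n] ((g ℕ.* a) ℕ.^ 2 ℕ.* (h ℕ.* x)) _
  n²∣m : (g ℕ.* a ℕ.* b) ℕ.^ 2 ∣ m
  n²∣m = subst (_∣ m) (trans (cong (ℕ._* b ℕ.^ 2) (sym (square-* g a))) (sym (square-* (g ℕ.* a) b)))
    (coprime-*-∣ (coprime-^2 (Coprimality.sym (coprime-^2 (Coprimality.sym ab))))
      (subst (_∣ m) (square-* g a) (ℕ∣.m*n∣⇒m∣ _ (h ℕ.* x) ∣ˡ))
      (subst (_∣ m) (square-* g b) (ℕ∣.m*n∣⇒m∣ _ (h ℕ.* y) ∣ʳ)))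
  D∣m : h ℕ.* x ℕ.* y ∣ m
  D∣m = coprime-*-∣ xy (ℕ∣.m*n∣⇒n∣ ((g ℕ.* a) ℕ.^ 2) _ ∣ˡ) (ℕ∣.m*n∣⇒n∣ ((g ℕ.* b) ℕ.^ 2) _ ∣ʳ)

smooth-* : ∀ {Δ m n} → PrimeFactorsDivide Δ m → PrimeFactorsDivide Δ n → PrimeFactorsDivide Δ (m ℕ.* n)
smooth-* {m = m} {n} sm sn q pr q∣mn = [ sm q pr , sn q pr ]′ (euclidsLemma m n pr q∣mn)

smooth-∣ : ∀ {Δ m n} → m ∣ n → PrimeFactorsDivide Δ n → PrimeFactorsDivide Δ m
smooth-∣ m∣n sn q pr q∣m = sn q pr (ℕ∣.∣-trans q∣m m∣n)

coprime-smooth : ∀ {Δ n d} → 1 ℕ.≤ d → Coprime n ℤ.∣ Δ ∣ → PrimeFactorsDivide Δ d → Coprime n d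
coprime-smooth {d = d} 1≤d cop smooth {zero} (_ , 0∣d) =
  contradiction (ℕ∣.0∣⇒≡0 0∣d) (ℕP.>⇒≢ 1≤d)
coprime-smooth 1≤d cop smooth {c@(suc _)} (c∣n , c∣d) with factorise c
... | record { factors = [] ; isFactorisation = c≡1 } = c≡1
... | record { factors = p ∷ ps ; isFactorisation = c≡ ; factorsPrime = pr ∷ _ } =
  contradiction (cop (ℕ∣.∣-trans p∣c c∣n , smooth p pr (ℕ∣.∣-trans p∣c c∣d)))
    (ℕP.>⇒≢ (ℕ.nonTrivial⇒n>1 p {{prime⇒nonTrivial pr}}))
  where
  p∣c : p ∣ c
  p∣c = subst (p ∣_) (sym c≡) (ℕ∣.m∣m*n (product ps))

decode : ∀ {N} → Code N → Quadruple
decode (((g , a) , b) , ((u , v) , w)) =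
  dyadicValue g ℕ.* dyadicValue a , dyadicValue g ℕ.* dyadicValue b ,
  value u ℕ.* value v , value u ℕ.* value w

^-cancel-< : ∀ b {m n} .{{_ : ℕ.NonZero b}} → b ℕ.^ m ℕ.< b ℕ.^ n → m ℕ.< n
^-cancel-< b bm<bn = ℕP.≰⇒> λ n≤m → ℕP.<⇒≱ bm<bn (ℕP.^-monoʳ-≤ b n≤m)

4^≡2^ : ∀ k → 4 ℕ.^ k ≡ 2 ℕ.^ (k ℕ.+ k)
4^≡2^ k = trans (ℕP.^-*-assoc 2 2 k) (cong (λ j → 2 ℕ.^ (k ℕ.+ j)) (ℕP.+-identityʳ k))

1≤*⇒1≤ : ∀ {m n} → 1 ℕ.≤ m ℕ.* n → 1 ℕ.≤ m × 1 ℕ.≤ n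
1≤*⇒1≤ {zero}          ()
1≤*⇒1≤ {suc m} {zero}  1≤ rewrite ℕP.*-zeroʳ m = contradiction 1≤ λ ()
1≤*⇒1≤ {suc m} {suc n} 1≤ = s≤s z≤n , s≤s z≤n

summand≤weight : ∀ {N} t (c : Code N) → IsCode c →
  let (((g , a) , b) , ((u , v) , w)) = c
      n = dyadicValue g ℕ.* dyadicValue a ℕ.* dyadicValue b
      D = value u ℕ.* value v ℕ.* value w in
  modulus (decode c) ≡ n ℕ.^ 2 ℕ.* D → 4 ℕ.^ t ℕ.≤ 4 ℕ.* modulus (decode c) →
  summand (decode c) ≤ ι 32 * ½ ^ t * weight t c
summand≤weight t c@(((g@(e₁ , _) , a@(e₂ , _)) , b@(e₃ , _)) , ((u , v) , w)) ((g< , a<) , b<) m≡n²D 4^t≤4m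
  with ^-bracket 4 (s≤s (s≤s z≤n)) (value u ℕ.* value v ℕ.* value w)
         (ℕP.*-mono-≤ (ℕP.*-mono-≤ (1≤value u) (1≤value v)) (1≤value w))
... | E , 4^E≤D , D<4^1+E =
  recip≤weight c {modulus (decode c)} {t} {E} {e ℕ.+ E ℕ.+ 4 ℕ.∸ t} 2^≤m (sym (ℕP.m+[n∸m]≡n t≤)) Ω≤
  where
  open ℕP.≤-Reasoning
  e n D : ℕ
  e = e₁ ℕ.+ e₂ ℕ.+ e₃
  n = dyadicValue g ℕ.* dyadicValue a ℕ.* dyadicValue b
  D = value u ℕ.* value v ℕ.* value w
  2^₃ : ∀ i j k → 2 ℕ.^ (i ℕ.+ j ℕ.+ k) ≡ 2 ℕ.^ i ℕ.* 2 ℕ.^ j ℕ.* 2 ℕ.^ k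
  2^₃ i j k = trans (ℕP.^-distribˡ-+-* 2 (i ℕ.+ j) k) (cong (ℕ._* 2 ℕ.^ k) (ℕP.^-distribˡ-+-* 2 i j))
  2^e≤n : 2 ℕ.^ e ℕ.≤ n
  2^e≤n = ℕP.≤-trans (ℕP.≤-reflexive (2^₃ e₁ e₂ e₃))
    (ℕP.*-mono-≤ (ℕP.*-mono-≤ (2^≤dyadicValue g) (2^≤dyadicValue a)) (2^≤dyadicValue b))
  n<2^ : n ℕ.< 2 ℕ.^ (suc e₁ ℕ.+ suc e₂ ℕ.+ suc e₃)
  n<2^ = ℕP.<-≤-trans
    (ℕP.*-mono-< (ℕP.*-mono-< (dyadicValue<2^ g g<) (dyadicValue<2^ a a<)) (dyadicValue<2^ b b<))
    (ℕP.≤-reflexive (sym (2^₃ (suc e₁) (suc e₂) (suc e₃))))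
  2^≤m : 2 ℕ.^ (e ℕ.+ (e ℕ.+ E ℕ.+ E)) ℕ.≤ modulus (decode c)
  2^≤m = begin
    2 ℕ.^ (e ℕ.+ (e ℕ.+ E ℕ.+ E))
      ≡⟨ cong (2 ℕ.^_) (solveℕ 2 (λ e E → e ⊕ (e ⊕ E ⊕ E) ⊜ e ⊕ e ⊕ (E ⊕ E)) refl e E) ⟩
    2 ℕ.^ (e ℕ.+ e ℕ.+ (E ℕ.+ E))             ≡⟨ 2^₃ e e (E ℕ.+ E) ⟩
    2 ℕ.^ e ℕ.* 2 ℕ.^ e ℕ.* 2 ℕ.^ (E ℕ.+ E)
      ≤⟨ ℕP.*-mono-≤ (ℕP.*-mono-≤ 2^e≤n 2^e≤n) (ℕP.≤-trans (ℕP.≤-reflexive (sym (4^≡2^ E))) 4^E≤D) ⟩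
    n ℕ.* n ℕ.* D                             ≡⟨ cong (λ k → n ℕ.* k ℕ.* D) (ℕP.*-identityʳ n) ⟨
    n ℕ.^ 2 ℕ.* D                             ≡⟨ m≡n²D ⟨
    modulus (decode c)                        ∎
  t≤ : t ℕ.≤ e ℕ.+ E ℕ.+ 4
  t≤ = ℕP.≤-pred (^-cancel-< 4 (begin-strict
    4 ℕ.^ t                            ≤⟨ 4^t≤4m ⟩
    4 ℕ.* modulus (decode c)           ≡⟨ cong (4 ℕ.*_) m≡n²D ⟩
    4 ℕ.* (n ℕ.* (n ℕ.* 1) ℕ.* D)      ≡⟨ cong (λ k → 4 ℕ.* (n ℕ.* k ℕ.* D)) (ℕP.*-identityʳ n) ⟩
    4 ℕ.* (n ℕ.* n ℕ.* D)              <⟨ ℕP.*-monoʳ-< 4 (ℕP.*-mono-< (ℕP.*-mono-< n<2^ n<2^) D<4^1+E) ⟩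
    4 ℕ.* (2 ℕ.^ k ℕ.* 2 ℕ.^ k ℕ.* 4 ℕ.^ suc E)
      ≡⟨ cong (λ j → 4 ℕ.* (j ℕ.* 4 ℕ.^ suc E)) (trans (sym (ℕP.^-distribˡ-+-* 2 k k)) (sym (4^≡2^ k))) ⟩
    4 ℕ.* (4 ℕ.^ k ℕ.* 4 ℕ.^ suc E)    ≡⟨ cong (4 ℕ.*_) (ℕP.^-distribˡ-+-* 4 k (suc E)) ⟨
    4 ℕ.^ suc (k ℕ.+ suc E)            ≡⟨ cong (4 ℕ.^_) (solveℕ 4 (λ a b c E →
      conℕ 1 ⊕ ((conℕ 1 ⊕ a) ⊕ (conℕ 1 ⊕ b) ⊕ (conℕ 1 ⊕ c) ⊕ (conℕ 1 ⊕ E)) ⊜ conℕ 1 ⊕ (a ⊕ b ⊕ c ⊕ E ⊕ conℕ 4))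
      refl e₁ e₂ e₃ E) ⟩
    4 ℕ.^ suc (e ℕ.+ E ℕ.+ 4)          ∎))
    where
    k : ℕ
    k = suc e₁ ℕ.+ suc e₂ ℕ.+ suc e₃
  Ω≤ : total u ℕ.+ total v ℕ.+ total w ℕ.≤ suc (E ℕ.+ E)
  Ω≤ = ℕP.≤-pred (^-cancel-< 2 (begin-strict
    2 ℕ.^ (total u ℕ.+ total v ℕ.+ total w) ≡⟨ 2^₃ (total u) (total v) (total w) ⟩
    2 ℕ.^ total u ℕ.* 2 ℕ.^ total v ℕ.* 2 ℕ.^ total w
      ≤⟨ ℕP.*-mono-≤ (ℕP.*-mono-≤ (2^total≤value u) (2^total≤value v)) (2^total≤value w) ⟩
    D                                       <⟨ D<4^1+E ⟩
    4 ℕ.^ suc E                             ≡⟨ 4^≡2^ (suc E) ⟩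
    2 ℕ.^ (suc E ℕ.+ suc E)                 ≡⟨ cong (λ k → 2 ℕ.^ suc k) (ℕP.+-suc E E) ⟩
    2 ℕ.^ suc (suc (E ℕ.+ E))               ∎))

module _ {Δ : ℤ} (Δ≢0 : Δ ≢ 0ℤ) where

  encode : ∀ X i → InRange Δ X i → ∀ t → 4 ℕ.^ t ℕ.≤ 4 ℕ.* modulus i →
    ∃ λ (c : Code ℤ.∣ Δ ∣) → IsCode c × decode c ≡ i × summand i ≤ ι 32 * ½ ^ t * weight t c
  encode X (r₁ , r₂ , d₁ , d₂)
    ((1≤r₁ , r₁⊥Δ) , (1≤r₂ , r₂⊥Δ) , (1≤d₁ , d₁∣Δ^) , (1≤d₂ , d₂∣Δ^) , _) t 4^t≤4m
    with gcd-split r₁ r₂ 1≤r₁ | gcd-split d₁ d₂ 1≤d₁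
  ... | g , a , b , refl , refl , a⊥b | h , x , y , refl , refl , x⊥y
    with toDyadic g (proj₁ (1≤*⇒1≤ 1≤r₁)) | toDyadic a (proj₂ (1≤*⇒1≤ {g} 1≤r₁)) | toDyadic b (proj₂ (1≤*⇒1≤ {g} 1≤r₂))
       | toExponents Δ≢0 {h} (proj₁ (1≤*⇒1≤ 1≤d₁)) (smooth-∣ {Δ} (ℕ∣.m∣m*n x) d₁∣Δ^)
       | toExponents Δ≢0 {x} (proj₂ (1≤*⇒1≤ {h} 1≤d₁)) (smooth-∣ {Δ} (ℕ∣.n∣m*n h) d₁∣Δ^)
       | toExponents Δ≢0 {y} (proj₂ (1≤*⇒1≤ {h} 1≤d₂)) (smooth-∣ {Δ} (ℕ∣.n∣m*n h) d₂∣Δ^)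
  ... | g′ , g< , refl | a′ , a< , refl | b′ , b< , refl | u , refl | v , refl | w , refl =
    c , ((g< , a<) , b<) , refl , summand≤weight t c ((g< , a<) , b<)
      (modulus-split g a b h x y (proj₁ (1≤*⇒1≤ 1≤r₁)) (1≤value u) a⊥b x⊥y
        (coprime-smooth {Δ} (ℕP.*-mono-≤ 1≤d₁ (1≤value w))
          (coprime-*ˡ {g ℕ.* a} (coprimeΔ (g ℕ.* a) r₁⊥Δ)
            (coprime-∣ˡ (ℕ∣.n∣m*n g) (coprimeΔ (g ℕ.* b) r₂⊥Δ)))
          (smooth-* {Δ} {h ℕ.* x} {y} d₁∣Δ^ (smooth-∣ {Δ} (ℕ∣.n∣m*n h) d₂∣Δ^))))
      4^t≤4m
    where
    c : Code ℤ.∣ Δ ∣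
    c = ((g′ , a′) , b′) , ((u , v) , w)
    coprimeΔ : ∀ r → CoprimeTo Δ r → Coprime r ℤ.∣ Δ ∣
    coprimeΔ r = gcd≡1⇒coprime {r} ∘ ℤP.+-injective

  ∑summand≤ : ∀ X t is → Unique is → All (InRange Δ X) is → All (λ i → 4 ℕ.^ t ℕ.≤ 4 ℕ.* modulus i) is →
    ∑ is summand ≤ ι 32 * ½ ^ t *
      (ι (8 ℕ.+ t) * ι (8 ℕ.+ t) * ι 16 * (ι 8 ^ ℤ.∣ Δ ∣ * ι 8 ^ ℤ.∣ Δ ∣ * ι 8 ^ ℤ.∣ Δ ∣))
  ∑summand≤ X t is is! inRange large = ∑≤majorant decode
    (majorised-*ˡ (0≤* (0≤ι 32) (0≤½^ t)) (majorised-weight t ℤ.∣ Δ ∣)) is!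
    (All.zipWith (λ (r , l) → encode X _ r t l) (inRange , large))

-- Logarithms and square roots

bernoulli-≤ : ∀ {w} → 0ℚ ≤ w → w ≤ 1ℚ → ∀ n → 1ℚ - ι n * w ≤ (1ℚ - w) ^ n
bernoulli-≤ {w} 0≤w w≤1 zero    = ≤-reflexive (solve 1 (λ w → con 1ℚ :- con 0ℚ :* w := con 1ℚ) refl w)
bernoulli-≤ {w} 0≤w w≤1 (suc n) = begin
  1ℚ - ι (suc n) * w               ≡⟨ cong (λ i → 1ℚ - i * w) (ι-suc n) ⟩
  1ℚ - (1ℚ + ι n) * w              ≤⟨ ≤-by (ι n * (w * w)) (solve 2 (λ i w →
    (con 1ℚ :- w) :* (con 1ℚ :- i :* w) := con 1ℚ :- (con 1ℚ :+ i) :* w :+ i :* (w :* w)) refl (ι n) w)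
    (0≤* (0≤ι n) (0≤* 0≤w 0≤w)) ⟩
  (1ℚ - w) * (1ℚ - ι n * w)        ≤⟨ *-monoˡ (≤⇒0≤- w≤1) (bernoulli-≤ 0≤w w≤1 n) ⟩
  (1ℚ - w) ^ suc n                 ∎
  where open ≤-Reasoning

sumTo-≥ : ∀ {f c} K j → (∀ k → k ℕ.< j ℕ.+ K → c ≤ f k) → sumTo K f + ι j * c ≤ sumTo (j ℕ.+ K) f
sumTo-≥ {f} {c} K zero    c≤ = ≤-reflexive (trans (cong (sumTo K f +_) (*-zeroˡ c)) (+-identityʳ _))
sumTo-≥ {f} {c} K (suc j) c≤ = begin
  sumTo K f + ι (suc j) * c        ≡⟨ cong (λ i → sumTo K f + i * c) (ι-suc j) ⟩
  sumTo K f + (1ℚ + ι j) * c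
    ≡⟨ solve 3 (λ s i c → s :+ (con 1ℚ :+ i) :* c := s :+ i :* c :+ c) refl (sumTo K f) (ι j) c ⟩
  sumTo K f + ι j * c + c          ≤⟨ +-mono-≤ (sumTo-≥ K j (λ k k< → c≤ k (ℕP.m≤n⇒m≤1+n k<)))
                                              (c≤ (j ℕ.+ K) ℕP.≤-refl) ⟩
  sumTo (suc j ℕ.+ K) f            ∎
  where open ≤-Reasoning

-- For k < 2^(j+1) ≤ 2^J the k-th term of the series is at least ½ · 2^-(j+2), as the power in it
-- is at least ½; so each dyadic block contributes at least ⅛.
artanh-≥ : ∀ {a} J n → ι (2 ℕ.^ (3 ℕ.+ J)) ≤ a + 1ℚ → 2 ℕ.^ J ℕ.≤ n →
  ι J * (½ ^ 3) ≤ artanhPartial n ((a - 1ℚ) * recip (a + 1ℚ))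
artanh-≥ {a} J n 2^≤a+1 2^J≤n = begin
  ι J * ½ ^ 3                            ≤⟨ blocks J ℕP.≤-refl ⟩
  sumTo (2 ℕ.^ J) (artanhTerm z)         ≡⟨ +-identityʳ _ ⟨
  sumTo (2 ℕ.^ J) (artanhTerm z) + 0ℚ    ≡⟨ cong (sumTo (2 ℕ.^ J) (artanhTerm z) +_) (*-zeroʳ (ι (n ℕ.∸ 2 ℕ.^ J))) ⟨
  sumTo (2 ℕ.^ J) (artanhTerm z) + ι (n ℕ.∸ 2 ℕ.^ J) * 0ℚ
    ≤⟨ sumTo-≥ (2 ℕ.^ J) (n ℕ.∸ 2 ℕ.^ J) (λ k _ → term≥0 k) ⟩
  sumTo (n ℕ.∸ 2 ℕ.^ J ℕ.+ 2 ℕ.^ J) (artanhTerm z)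
    ≡⟨ cong (λ k → sumTo k (artanhTerm z)) (ℕP.m∸n+n≡m 2^J≤n) ⟩
  artanhPartial n z                      ∎
  where
  open ≤-Reasoning
  u w z : ℚ
  u = recip (a + 1ℚ)
  w = ι 2 * u
  z = (a - 1ℚ) * u
  0<a+1 : 0ℚ < a + 1ℚ
  0<a+1 = <-≤-trans (0<ι[2^n] (3 ℕ.+ J)) 2^≤a+1
  0≤w : 0ℚ ≤ w
  0≤w = 0≤* (0≤ι 2) (<⇒≤ (0<recip 0<a+1))
  w≤ : w ≤ ι 2 * ½ ^ (3 ℕ.+ J)
  w≤ = *-monoˡ (0≤ι 2) (≤-trans (recip-antimono (0<ι[2^n] (3 ℕ.+ J)) 2^≤a+1)
    (≤-reflexive (recip-ι[2^n] (3 ℕ.+ J))))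
  powers : ι (2 ℕ.^ suc J) * w ≤ ½
  powers = begin
    ι (2 ℕ.^ suc J) * w                     ≤⟨ *-monoˡ (0≤ι _) w≤ ⟩
    ι (2 ℕ.^ suc J) * (ι 2 * ½ ^ (3 ℕ.+ J))
      ≡⟨ solve 2 (λ i h → i :* (con (ι 2) :* (con ½ :* (con ½ :* h))) := i :* h :* con ½) refl
           (ι (2 ℕ.^ suc J)) (½ ^ suc J) ⟩
    ι (2 ℕ.^ suc J) * ½ ^ suc J * ½         ≡⟨ cong (_* ½) (ι[2^n]*½^n≡1 (suc J)) ⟩
    1ℚ * ½                                  ≡⟨⟩
    ½                                       ∎
  w≤1 : w ≤ 1ℚ
  w≤1 = begin
    w                       ≡⟨ *-identityˡ w ⟨
    1ℚ * w                  ≤⟨ *-mono 0≤1 (ι-mono (ℕP.m^n>0 2 (suc J))) 0≤w ≤-refl ⟩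
    ι (2 ℕ.^ suc J) * w     ≤⟨ powers ⟩
    ½                       ≤⟨ from-yes (½ ≤? 1ℚ) ⟩
    1ℚ                      ∎
  z≡1-w : z ≡ 1ℚ - w
  z≡1-w = trans
    (solve 2 (λ a u → (a :- con 1ℚ) :* u := (a :+ con 1ℚ) :* u :- con (ι 2) :* u) refl a u)
    (cong (_- w) (*-recip 0<a+1))
  0≤z : 0ℚ ≤ z
  0≤z = subst (0ℚ ≤_) (sym z≡1-w) (≤⇒0≤- w≤1)
  term≥0 : ∀ k → 0ℚ ≤ artanhTerm z k
  term≥0 k = 0≤* (0≤^ 0≤z (suc (2 ℕ.* k))) (<⇒≤ (0<ε (2 ℕ.* k)))
  term≥ : ∀ j → suc j ℕ.≤ J → ∀ k → k ℕ.< 2 ℕ.^ suc j → ½ ^ (j ℕ.+ 3) ≤ artanhTerm z k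
  term≥ j j<J k k< = begin
    ½ ^ (j ℕ.+ 3)                     ≡⟨ cong (½ ^_) (ℕP.+-comm j 3) ⟩
    ½ * ½ ^ suc (suc j)               ≤⟨ *-mono (<⇒≤ 0<½) power≥ (0≤½^ (suc (suc j))) recip≥ ⟩
    artanhTerm z k                    ∎
    where
    1+2k≤ : suc (2 ℕ.* k) ℕ.≤ 2 ℕ.^ suc (suc j)
    1+2k≤ = ℕP.*-monoʳ-< 2 k<
    recip≥ : ½ ^ suc (suc j) ≤ recip (ι (suc (2 ℕ.* k)))
    recip≥ = ≤-trans (≤-reflexive (sym (recip-ι[2^n] (suc (suc j)))))
      (recip-antimono (0<ιsuc (2 ℕ.* k)) (ι-mono 1+2k≤))
    power≥ : ½ ≤ z ^ suc (2 ℕ.* k)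
    power≥ = begin
      1ℚ - ½                          ≤⟨ +-monoʳ-≤ 1ℚ (neg-antimono-≤ (≤-trans
                                           (*-mono (0≤ι (suc (2 ℕ.* k)))
                                             (ι-mono (ℕP.≤-trans 1+2k≤ (ℕP.^-monoʳ-≤ 2 (s≤s j<J)))) 0≤w ≤-refl)
                                           powers)) ⟩
      1ℚ - ι (suc (2 ℕ.* k)) * w      ≤⟨ bernoulli-≤ 0≤w w≤1 (suc (2 ℕ.* k)) ⟩
      (1ℚ - w) ^ suc (2 ℕ.* k)        ≡⟨ cong (_^ suc (2 ℕ.* k)) z≡1-w ⟨
      z ^ suc (2 ℕ.* k)               ∎
  blocks : ∀ j → j ℕ.≤ J → ι j * ½ ^ 3 ≤ sumTo (2 ℕ.^ j) (artanhTerm z)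
  blocks zero    _   = ≤-trans (≤-reflexive (*-zeroˡ (½ ^ 3))) (≤-trans (term≥0 0) (≤-reflexive (sym (+-identityˡ _))))
  blocks (suc j) j<J = begin
    ι (suc j) * ½ ^ 3                   ≡⟨ cong (_* ½ ^ 3) (ι-suc j) ⟩
    (1ℚ + ι j) * ½ ^ 3                  ≡⟨ solve 2 (λ i h → (con 1ℚ :+ i) :* h := i :* h :+ con 1ℚ :* h) refl (ι j) (½ ^ 3) ⟩
    ι j * ½ ^ 3 + 1ℚ * ½ ^ 3            ≤⟨ +-monoˡ-≤ (1ℚ * ½ ^ 3) (blocks j (ℕP.<⇒≤ j<J)) ⟩
    S + 1ℚ * ½ ^ 3                      ≡⟨ cong (λ p → S + p * ½ ^ 3) (ι[2^n]*½^n≡1 j) ⟨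
    S + ι (2 ℕ.^ j) * ½ ^ j * ½ ^ 3     ≡⟨ cong (S +_) (trans (*-assoc (ι (2 ℕ.^ j)) (½ ^ j) (½ ^ 3))
                                             (cong (ι (2 ℕ.^ j) *_) (sym (^-homo-* ½ j 3)))) ⟩
    S + ι (2 ℕ.^ j) * ½ ^ (j ℕ.+ 3)
      ≤⟨ sumTo-≥ (2 ℕ.^ j) (2 ℕ.^ j) (λ k k< → term≥ j j<J k (subst (k ℕ.<_) 2^j+2^j≡ k<)) ⟩
    sumTo (2 ℕ.^ j ℕ.+ 2 ℕ.^ j) (artanhTerm z)   ≡⟨ cong (λ k → sumTo k (artanhTerm z)) 2^j+2^j≡ ⟩
    sumTo (2 ℕ.^ suc j) (artanhTerm z)  ∎
    where
    S : ℚ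
    S = sumTo (2 ℕ.^ j) (artanhTerm z)
    2^j+2^j≡ : 2 ℕ.^ j ℕ.+ 2 ℕ.^ j ≡ 2 ℕ.^ suc j
    2^j+2^j≡ = cong (2 ℕ.^ j ℕ.+_) (sym (ℕP.+-identityʳ (2 ℕ.^ j)))

ι-cancel-≤ : ∀ {m n} → ι m ≤ ι n → m ℕ.≤ n
ι-cancel-≤ {m} {n} m≤n = ℤP.drop‿+≤+ (subst₂ ℤ._≤_ (ℤP.*-identityʳ (ℤ.+ m)) (ℤP.*-identityʳ (ℤ.+ n)) (drop-*≤* m≤n))

ι-bracket : ∀ {q} → 1ℚ ≤ q → ∃ λ T → ι (4 ℕ.^ T) ≤ q × q < ι (4 ℕ.^ suc T)
ι-bracket {q} 1≤q with ^-bracket 4 (s≤s (s≤s z≤n)) (suc ℤ.∣ ↥ q ∣) (s≤s z≤n)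
... | e , _ , n<4^ = search (suc e) (≤-<-trans (p≤ι∣↥p∣ q) (ι-mono-< (ℕP.<-trans (ℕP.n<1+n _) n<4^)))
  where
  ι-mono-< : ∀ {m n} → m ℕ.< n → ι m < ι n
  ι-mono-< m<n = ≰⇒> λ n≤m → ℕP.<⇒≱ m<n (ι-cancel-≤ n≤m)
  search : ∀ B → q < ι (4 ℕ.^ B) → ∃ λ T → ι (4 ℕ.^ T) ≤ q × q < ι (4 ℕ.^ suc T)
  search zero    q<1 = contradiction (<-≤-trans q<1 1≤q) (<-irrefl refl)
  search (suc B) q<  with ι (4 ℕ.^ B) ≤? q
  ... | yes ≤q = B , ≤q , q<
  ... | no  ≰q = search B (≰⇒> ≰q)

0≤p² : ∀ p → 0ℚ ≤ p * p
0≤p² p with ≤-total 0ℚ p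
... | inj₁ 0≤p = 0≤* 0≤p 0≤p
... | inj₂ p≤0 = subst (0ℚ ≤_) (solve 1 (λ p → :- p :* :- p := p :* p) refl p)
  (0≤* (neg-antimono-≤ p≤0) (neg-antimono-≤ p≤0))

-- At l = J/4 this is Cauchy–Schwarz: (4l + 3)² ≤ (4² + 3²)(l² + 1²).
square≤25[l²+1] : ∀ {J l} → ι J * ½ ^ 2 ≤ l → ι (3 ℕ.+ J) * ι (3 ℕ.+ J) ≤ ι 25 * (l * l + 1ℚ)
square≤25[l²+1] {J} {l} J≤ = begin
  ι (3 ℕ.+ J) * ι (3 ℕ.+ J)            ≡⟨ cong (λ i → i * i) ι3+J ⟩
  (ι 3 + ι J) * (ι 3 + ι J)
    ≤⟨ ≤-by ((ι 3 * j - ι 4) * (ι 3 * j - ι 4)) (solve 1 (λ i →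
         con (ι 25) :* (i :* con (½ ^ 2) :* (i :* con (½ ^ 2)) :+ con 1ℚ) :=
         (con (ι 3) :+ i) :* (con (ι 3) :+ i) :+
         (con (ι 3) :* (i :* con (½ ^ 2)) :- con (ι 4)) :* (con (ι 3) :* (i :* con (½ ^ 2)) :- con (ι 4)))
         refl (ι J)) (0≤p² (ι 3 * j - ι 4)) ⟩
  ι 25 * (j * j + 1ℚ)                  ≤⟨ *-monoˡ (0≤ι 25) (+-monoˡ-≤ 1ℚ (*-mono 0≤j J≤ 0≤j J≤)) ⟩
  ι 25 * (l * l + 1ℚ)                  ∎
  where
  open ≤-Reasoning
  j : ℚ
  j = ι J * ½ ^ 2
  0≤j : 0ℚ ≤ j
  0≤j = 0≤* (0≤ι J) (0≤½^ 2)
  ι3+J : ι (3 ℕ.+ J) ≡ ι 3 + ι J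
  ι3+J = begin-equality
    ι (3 ℕ.+ J)                ≡⟨ ι-suc (2 ℕ.+ J) ⟩
    1ℚ + ι (2 ℕ.+ J)           ≡⟨ cong (1ℚ +_) (ι-suc (1 ℕ.+ J)) ⟩
    1ℚ + (1ℚ + ι (1 ℕ.+ J))    ≡⟨ cong (λ i → 1ℚ + (1ℚ + i)) (ι-suc J) ⟩
    1ℚ + (1ℚ + (1ℚ + ι J))     ≡⟨ solve 1 (λ i → con 1ℚ :+ (con 1ℚ :+ (con 1ℚ :+ i)) := con (ι 3) :+ i) refl (ι J) ⟩
    ι 3 + ι J                  ∎

[1+T]²≤log² : ∀ {a} T n → ι (4 ℕ.^ T) ≤ a + 1ℚ → 2 ℕ.^ T ℕ.≤ n →
  let l = ι 2 * artanhPartial n ((a - 1ℚ) * recip (a + 1ℚ)) in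
  ι (suc T) * ι (suc T) ≤ ι 25 * (l * l + 1ℚ)
[1+T]²≤log² {a} T n 4^T≤a+1 2^T≤n = byCases T 4^T≤a+1 2^T≤n
  where
  open ≤-Reasoning
  l : ℚ
  l = ι 2 * artanhPartial n ((a - 1ℚ) * recip (a + 1ℚ))
  small : ∀ T → T ℕ.≤ 1 → ι (suc T) * ι (suc T) ≤ ι 25 * (l * l + 1ℚ)
  small T T≤1 = begin
    ι (suc T) * ι (suc T)   ≤⟨ *-mono (0≤ι (suc T)) (ι-mono (s≤s T≤1)) (0≤ι (suc T)) (ι-mono (s≤s T≤1)) ⟩
    ι 2 * ι 2               ≤⟨ from-yes (ι 2 * ι 2 ≤? ι 25 * 1ℚ) ⟩
    ι 25 * 1ℚ               ≤⟨ *-monoˡ (0≤ι 25) (≤-by (l * l) (+-comm (l * l) 1ℚ) (0≤p² l)) ⟩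
    ι 25 * (l * l + 1ℚ)     ∎
  byCases : ∀ T → ι (4 ℕ.^ T) ≤ a + 1ℚ → 2 ℕ.^ T ℕ.≤ n → ι (suc T) * ι (suc T) ≤ ι 25 * (l * l + 1ℚ)
  byCases 0 _ _ = small 0 z≤n
  byCases 1 _ _ = small 1 ℕP.≤-refl
  byCases (suc (suc J)) 4^≤ 2^≤ = square≤25[l²+1] {J} {l} (begin
    ι J * ½ ^ 2             ≡⟨ solve 1 (λ i → i :* con (½ ^ 2) := con (ι 2) :* (i :* con (½ ^ 3))) refl (ι J) ⟩
    ι 2 * (ι J * ½ ^ 3)
      ≤⟨ *-monoˡ (0≤ι 2) (artanh-≥ {a} J n (≤-trans (ι-mono 2^≤4^) 4^≤)
           (ℕP.≤-trans (ℕP.^-monoʳ-≤ 2 (ℕP.m≤n+m J 2)) 2^≤)) ⟩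
    l                       ∎)
    where
    2^≤4^ : 2 ℕ.^ (3 ℕ.+ J) ℕ.≤ 4 ℕ.^ (2 ℕ.+ J)
    2^≤4^ = ℕP.≤-trans (ℕP.^-monoʳ-≤ 2 (ℕP.+-mono-≤ {3} {4} {J} (ℕP.n≤1+n 3) (ℕP.m≤n*m J 2)))
      (ℕP.≤-reflexive (trans (cong (2 ℕ.^_) (sym (ℕP.*-distribˡ-+ 2 2 J))) (sym (ℕP.^-*-assoc 2 2 (2 ℕ.+ J)))))

½^≤recip : ∀ {a s e} T → ½ ≤ a → a < ι (4 ℕ.^ suc T) → 0ℚ ≤ s → 0ℚ ≤ e → e ≤ ½ →
  s ≡ 0ℚ ⊎ s * s ≤ a → a < (s + e) * (s + e) → ½ ^ suc T ≤ recip s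
½^≤recip {a} {s} {e} T ½≤a a<4^ 0≤s 0≤e e≤½ lower upper =
  ≤-trans (≤-reflexive (sym (recip-ι[2^n] (suc T)))) (recip-antimono 0<s (s≤2^ lower))
  where
  open ≤-Reasoning
  square-mono : ∀ {p q} → 0ℚ ≤ p → p ≤ q → p * p ≤ q * q
  square-mono 0≤p p≤q = *-mono 0≤p p≤q 0≤p p≤q
  0<s : 0ℚ < s
  0<s = ≰⇒> λ s≤0 → <-irrefl refl (<-≤-trans upper (begin
    (s + e) * (s + e)       ≤⟨ square-mono (0≤+ 0≤s 0≤e) (+-mono-≤ s≤0 e≤½) ⟩
    (0ℚ + ½) * (0ℚ + ½)     ≤⟨ from-yes ((0ℚ + ½) * (0ℚ + ½) ≤? ½) ⟩
    ½                       ≤⟨ ½≤a ⟩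
    a                       ∎))
  4^≡ : 4 ℕ.^ suc T ≡ 2 ℕ.^ suc T ℕ.* 2 ℕ.^ suc T
  4^≡ = trans (4^≡2^ (suc T)) (ℕP.^-distribˡ-+-* 2 (suc T) (suc T))
  s≤2^ : s ≡ 0ℚ ⊎ s * s ≤ a → s ≤ ι (2 ℕ.^ suc T)
  s≤2^ (inj₁ s≡0)  = ≤-trans (≤-reflexive s≡0) (0≤ι (2 ℕ.^ suc T))
  s≤2^ (inj₂ s²≤a) = ≮⇒≥ λ 2^<s → <-irrefl refl (<-≤-trans a<4^ (begin
    ι (4 ℕ.^ suc T)                       ≡⟨ cong ι 4^≡ ⟩
    ι (2 ℕ.^ suc T ℕ.* 2 ℕ.^ suc T)       ≡⟨ ι-* (2 ℕ.^ suc T) (2 ℕ.^ suc T) ⟩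
    ι (2 ℕ.^ suc T) * ι (2 ℕ.^ suc T)     ≤⟨ square-mono (0≤ι (2 ℕ.^ suc T)) (<⇒≤ 2^<s) ⟩
    s * s                                 ≤⟨ s²≤a ⟩
    a                                     ∎))

½^≤recip-√ : ∀ {a} T n → 1 ℕ.≤ n → ½ ≤ a → a < ι (4 ℕ.^ suc T) → ½ ^ suc T ≤ recip (√ℚ n a)
½^≤recip-√ {a} T n 1≤n ½≤a a<4^ = ½^≤recip {a} {√ℚ n a} {ε n} T ½≤a a<4^
  (√ℚ-nonNeg n a) (<⇒≤ (0<ε n)) (ε-antimono 1≤n) (√ℚ-lower n a) (√ℚ-upper n a)

majorant≤ : ∀ T {L r K} → 0ℚ ≤ K → ι (suc T) * ι (suc T) ≤ ι 25 * L → ½ ^ suc T ≤ r →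
  ι 32 * ½ ^ T * (ι (8 ℕ.+ T) * ι (8 ℕ.+ T) * ι 16 * K) ≤
  ι 32 * ι 64 * ι 16 * ι 25 * ι 2 * K * (L * r)
majorant≤ T {L} {r} {K} 0≤K T²≤ ½^≤r = begin
  ι 32 * ½ ^ T * (ι (8 ℕ.+ T) * ι (8 ℕ.+ T) * ι 16 * K)
    ≤⟨ *-monoˡ (0≤* (0≤ι 32) (0≤½^ T)) (*-mono (0≤* (0≤* (0≤ι (8 ℕ.+ T)) (0≤ι (8 ℕ.+ T))) (0≤ι 16))
         (*-mono (0≤* (0≤ι (8 ℕ.+ T)) (0≤ι (8 ℕ.+ T))) (*-mono (0≤ι (8 ℕ.+ T)) 8+T≤ (0≤ι (8 ℕ.+ T)) 8+T≤) (0≤ι 16) ≤-refl)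
         0≤K ≤-refl) ⟩
  ι 32 * ½ ^ T * (ι 8 * S * (ι 8 * S) * ι 16 * K)
    ≡⟨ solve 3 (λ h s k → con (ι 32) :* h :* (con (ι 8) :* s :* (con (ι 8) :* s) :* con (ι 16) :* k)
               := con (ι 32) :* con (ι 64) :* con (ι 16) :* con (ι 2) :* k :* (s :* s :* (con ½ :* h))) refl (½ ^ T) S K ⟩
  ι 32 * ι 64 * ι 16 * ι 2 * K * (S * S * ½ ^ suc T)
    ≤⟨ *-monoˡ (0≤* (from-yes (0ℚ ≤? ι 32 * ι 64 * ι 16 * ι 2)) 0≤K)
         (*-mono (0≤* (0≤ι (suc T)) (0≤ι (suc T))) T²≤ (0≤½^ (suc T)) ½^≤r) ⟩
  ι 32 * ι 64 * ι 16 * ι 2 * K * (ι 25 * L * r)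
    ≡⟨ solve 3 (λ k l r → con (ι 32) :* con (ι 64) :* con (ι 16) :* con (ι 2) :* k :* (con (ι 25) :* l :* r)
               := con (ι 32) :* con (ι 64) :* con (ι 16) :* con (ι 25) :* con (ι 2) :* k :* (l :* r)) refl K L r ⟩
  ι 32 * ι 64 * ι 16 * ι 25 * ι 2 * K * (L * r) ∎
  where
  open ≤-Reasoning
  S : ℚ
  S = ι (suc T)
  8+T≤ : ι (8 ℕ.+ T) ≤ ι 8 * S
  8+T≤ = ≤-trans (ι-mono (ℕP.≤-trans (ℕP.+-monoʳ-≤ 8 (ℕP.m≤n*m T 8))
    (ℕP.≤-reflexive (sym (ℕP.*-suc 8 T))))) (≤-reflexive (ι-* 8 (suc T)))

¼ : ℚ
¼ = ½ ^ 2

lemma4p2 : (Δ : ℤ) → Δ ≢ 0ℤ →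
    ∃ λ (c : ℝ) → (X : ℝ) (1≤X : 1ᴿ ≤ᴿ X) →
      let 0<X = 1≤x⇒0<x X 1≤X
          logX = logᴿ X 0<X
      in ∑[ InRange Δ X ] summand ≤ᴿ
           (c *ᴿ ((logX *ᴿ logX +ᴿ 1ᴿ) /ᴿ √ᴿ X ⟨ 0<x⇒0<√x X 0<X ⟩))
lemma4p2 Δ Δ≢0 = fromℚ (ι 32 * ι 64 * ι 16 * ι 25 * ι 2 * K) , bound
  where
  K : ℚ
  K = ι 8 ^ ℤ.∣ Δ ∣ * ι 8 ^ ℤ.∣ Δ ∣ * ι 8 ^ ℤ.∣ Δ ∣
  0≤K : 0ℚ ≤ K
  0≤K = 0≤* (0≤* (0≤^ (0≤ι 8) ℤ.∣ Δ ∣) (0≤^ (0≤ι 8) ℤ.∣ Δ ∣)) (0≤^ (0≤ι 8) ℤ.∣ Δ ∣)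
  0<¼ : 0ℚ < ¼
  0<¼ = positive⁻¹ ¼
  bound : (X : ℝ) (1≤X : 1ᴿ ≤ᴿ X) →
      let 0<X = 1≤x⇒0<x X 1≤X
          logX = logᴿ X 0<X
      in ∑[ InRange Δ X ] summand ≤ᴿ
           (fromℚ (ι 32 * ι 64 * ι 16 * ι 25 * ι 2 * K) *ᴿ
             ((logX *ᴿ logX +ᴿ 1ᴿ) /ᴿ √ᴿ X ⟨ 0<x⇒0<√x X 0<X ⟩))
  bound X 1≤X is is! inRange η 0<η = N , eventually
    where
    M₁ M₂ M : ℕ
    M₁ = proj₁ (cauchy X ¼ 0<¼)
    M₂ = proj₁ (1≤X ¼ 0<¼)
    M = M₁ ℕ.⊔ M₂
    a₀ : ℚ
    a₀ = seq X M
    near : ∀ n → M ℕ.≤ n → seq X n ≤ a₀ + ¼ × a₀ ≤ seq X n + ¼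
    near n M≤n = shift _ _ (≤-trans (p≤∣p∣ _) d≤) ,
      shift _ _ (≤-trans (p≤∣p∣ _) (≤-trans (≤-reflexive (∣-∣-sym a₀ (seq X n))) d≤))
      where
      d≤ = proj₂ (cauchy X ¼ 0<¼) n M (ℕP.m⊔n≤o⇒m≤o M₁ M₂ M≤n) (ℕP.m≤m⊔n M₁ M₂)
      shift : ∀ p q → p - q ≤ ¼ → p ≤ q + ¼
      shift p q h = ≤-by (¼ - (p - q)) (solve 3 (λ p q r → q :+ r := p :+ (r :- (p :- q))) refl p q ¼) (≤⇒0≤- h)
    1≤X+¼ : ∀ n → M ℕ.≤ n → 1ℚ ≤ seq X n + ¼
    1≤X+¼ n M≤n = proj₂ (1≤X ¼ 0<¼) n (ℕP.m⊔n≤o⇒n≤o M₁ M₂ M≤n)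
    ¼≤½ : ¼ ≤ ½
    ¼≤½ = from-yes (¼ ≤? ½)
    bracket : ∃ λ T → ι (4 ℕ.^ T) ≤ a₀ + ½ × a₀ + ½ < ι (4 ℕ.^ suc T)
    bracket = ι-bracket (≤-trans (1≤X+¼ M ℕP.≤-refl) (+-monoʳ-≤ a₀ ¼≤½))
    T N : ℕ
    T = proj₁ bracket
    N = M ℕ.⊔ 2 ℕ.^ T
    large : ∀ i → InRange Δ X i → 4 ℕ.^ T ℕ.≤ 4 ℕ.* modulus i
    large i (_ , _ , _ , _ , X≤m) = ι-cancel-≤ (begin
      ι (4 ℕ.^ T)            ≤⟨ proj₁ (proj₂ bracket) ⟩
      a₀ + ½                 ≤⟨ +-monoˡ-≤ ½ (proj₂ (near n M≤n)) ⟩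
      x + ¼ + ½              ≤⟨ +-monoˡ-≤ ½ (+-monoˡ-≤ ¼ x≤m+¼) ⟩
      m + ¼ + ¼ + ½
        ≤⟨ ≤-by (ι 3 * (x + ¼ - 1ℚ) + ι 3 * (m + ¼ - x) + ½)
             (solve 2 (λ m x → con (ι 4) :* m := m :+ con ¼ :+ con ¼ :+ con ½ :+
               (con (ι 3) :* (x :+ con ¼ :- con 1ℚ) :+ con (ι 3) :* (m :+ con ¼ :- x) :+ con ½)) refl m x)
             (0≤+ (0≤+ (0≤* (0≤ι 3) (≤⇒0≤- (1≤X+¼ n M≤n))) (0≤* (0≤ι 3) (≤⇒0≤- x≤m+¼))) (<⇒≤ 0<½)) ⟩
      ι 4 * m                ≡⟨ ι-* 4 (modulus i) ⟨
      ι (4 ℕ.* modulus i)    ∎)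
      where
      open ≤-Reasoning
      n : ℕ
      n = M ℕ.⊔ proj₁ (X≤m ¼ 0<¼)
      M≤n : M ℕ.≤ n
      M≤n = ℕP.m≤m⊔n M _
      x m : ℚ
      x = seq X n
      m = ι (modulus i)
      x≤m+¼ : x ≤ m + ¼
      x≤m+¼ = proj₂ (X≤m ¼ 0<¼) n (ℕP.m≤n⊔m M _)
    eventually : ∀ n → N ℕ.≤ n → _
    eventually n N≤n = ≤-trans (≤-trans
      (∑summand≤ Δ≢0 X T is is! inRange (All.map (λ {i} → large i) inRange))
      (majorant≤ T {l * l + 1ℚ} {recip (√ℚ n (seq X n))} {K} 0≤K
        ([1+T]²≤log² {seq X n} T n
          (≤-trans (proj₁ (proj₂ bracket)) (≤-trans (+-monoˡ-≤ ½ (proj₂ (near n M≤n)))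
            (≤-by ¼ (solve 1 (λ x → x :+ con 1ℚ := x :+ con ¼ :+ con ½ :+ con ¼) refl (seq X n)) (<⇒≤ 0<¼))))
          2^T≤n)
        (½^≤recip-√ {seq X n} T n (ℕP.≤-trans (ℕP.m^n>0 2 T) 2^T≤n)
          (≤-by (seq X n + ¼ - 1ℚ + ¼)
            (solve 1 (λ x → x := con ½ :+ (x :+ con ¼ :- con 1ℚ :+ con ¼)) refl (seq X n))
            (0≤+ (≤⇒0≤- (1≤X+¼ n M≤n)) (<⇒≤ 0<¼)))
          (≤-<-trans (≤-trans (proj₁ (near n M≤n)) (+-monoʳ-≤ a₀ ¼≤½)) (proj₂ (proj₂ bracket))))))
      (≤-by η refl (<⇒≤ 0<η))
      where
      l : ℚ
      l = ι 2 * artanhPartial n ((seq X n - 1ℚ) * recip (seq X n + 1ℚ))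
      M≤n : M ℕ.≤ n
      M≤n = ℕP.m⊔n≤o⇒m≤o M (2 ℕ.^ T) N≤n
      2^T≤n : 2 ℕ.^ T ℕ.≤ n
      2^T≤n = ℕP.m⊔n≤o⇒n≤o M (2 ℕ.^ T) N≤n
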